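{- Let $\mathcal{D}$ be a set of $n$ unit disks in the plane, each intersecting a given straight line $L$, such that all the centers of the disks lie on one side of $L$. Then, in $O(n^4)$ time and $O(n^3)$ space, one can find a maximum-size subset $\mathcal{D}'\subseteq\mathcal{D}$ such that $\mathcal{D}'$ induces a bipartite subgraph of the intersection graph of $\mathcal{D}$.
   Context: Unit disks are closed disks of radius 1 in the plane. The centers lie on one side of $L$ means that all centers belong to one of the two closed half-planes bounded by $L$. The intersection graph of $\mathcal{D}$ has one vertex per disk, two vertices being adjacent if and only if the corresponding disks intersect. Running times count elementary operations, including arithmetic on real numbers, at unit cost. -}

module Defs where

open import Algebra.Bundles using (CommutativeRing)
open import Data.Bool.Base using (Bool; true; false; not; _∧_)
open import Data.Fin.Base using (Fin; toℕ; fromℕ<; inject≤)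
open import Data.Fin.Subset using (Subset; _∈_; ∣_∣)
open import Data.Maybe.Base using (Maybe; just; nothing; _>>=_)
import Data.Maybe.Base as Maybe
open import Data.Nat.Base as ℕ using (ℕ; suc; z≤n; s≤s)
import Data.Nat.Properties as ℕ
open import Data.Product.Base using (Σ; ∃; ∃-syntax; _×_; _,_; proj₁)
open import Data.Sum.Base using (_⊎_)
open import Data.Vec.Base using (Vec; []; _∷_; _++_; lookup; tabulate; padRight; _[_]≔_)
open import Function.Definitions using (Injective)
open import Level using (0ℓ)
open import Relation.Binary.Core using (Rel)
open import Relation.Binary.PropositionalEquality using (_≡_; _≢_; ≢-sym)
import Relation.Binary.PropositionalEquality as ≡
open import Relation.Binary.Structures using (IsDecTotalOrder)
open import Relation.Nullary using (¬_; yes; no; does)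
open import Relation.Nullary.Decidable using (dec⇒maybe)
open import Relation.Unary using (Pred; _≬_)

infix 4 _∈O_

_∈O_ : (ℕ → ℕ) → (ℕ → ℕ) → Set
f ∈O g = ∃[ c ] ∃[ N ] (∀ n → N ℕ.≤ n → f n ℕ.≤ c ℕ.* g n)

-- The classical axioms: a Dedekind-complete ordered field, unique up to
-- isomorphism.  Decidability of the order is automatic classically; here it
-- is assumed, because a real RAM branches on comparisons of reals.

record RealNumbers : Set₁ where
  infix 4 _≤_
  infix 9 _⁻¹
  field
    commutativeRing : CommutativeRing 0ℓ 0ℓ

  open CommutativeRing commutativeRing public

  field
    _≤_             : Rel Carrier 0ℓ
    isDecTotalOrder : IsDecTotalOrder _≈_ _≤_
    +-monoˡ-≤       : ∀ {x y} z → x ≤ y → x + z ≤ y + z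
    *-nonNeg        : ∀ {x y} → 0# ≤ x → 0# ≤ y → 0# ≤ x * y
    0≉1             : ¬ 0# ≈ 1#

    -- 0# ⁻¹ is an unspecified element.
    _⁻¹             : Carrier → Carrier
    ⁻¹-cong         : ∀ {x y} → x ≈ y → x ⁻¹ ≈ y ⁻¹
    *-inverseʳ      : ∀ x → ¬ x ≈ 0# → x * x ⁻¹ ≈ 1#

  UpperBound : Pred Carrier 0ℓ → Pred Carrier 0ℓ
  UpperBound P b = ∀ x → P x → x ≤ b

  field
    supremum : (P : Pred Carrier 0ℓ) → ∃ P → ∃ (UpperBound P) →
               ∃[ s ] (UpperBound P s × (∀ b → UpperBound P b → s ≤ b))

  open IsDecTotalOrder isDecTotalOrder public
    using (_≟_; _≤?_)

record Graph : Set₁ where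
  field
    Vertex : Set
    Adj    : Rel Vertex 0ℓ
    symm   : ∀ {u v} → Adj u v → Adj v u
    irrefl : ∀ {v} → ¬ Adj v v

module _ (G : Graph) where
  open Graph G

  induced : Pred Vertex 0ℓ → Graph
  induced P = record
    { Vertex = Σ Vertex P
    ; Adj    = λ u v → Adj (proj₁ u) (proj₁ v)
    ; symm   = symm
    ; irrefl = irrefl
    }

  Bipartite : Set
  Bipartite = Σ (Vertex → Bool) λ side → ∀ u v → Adj u v → side u ≢ side v

module Plane (ℝ : RealNumbers) where
  open RealNumbers ℝ

  record Point : Set where
    constructor ⟨_,_⟩
    field
      x y : Carrier

  open Point public

  infix 4 _≈ₚ_

  _≈ₚ_ : Rel Point 0ℓ
  p ≈ₚ q = x p ≈ x q × y p ≈ y q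

  sq : Carrier → Carrier
  sq a = a * a

  unitDisk : Point → Pred Point 0ℓ
  unitDisk c p = sq (x p + - x c) + sq (y p + - y c) ≤ 1#

  -- The line  a x + b y = c.
  record Line : Set where
    field
      a b c         : Carrier
      nondegenerate : ¬ (a ≈ 0# × b ≈ 0#)

  module _ (L : Line) where
    open Line L

    onLine halfPlane₁ halfPlane₂ : Pred Point 0ℓ
    onLine     p = a * x p + b * y p ≈ c
    halfPlane₁ p = a * x p + b * y p ≤ c
    halfPlane₂ p = c ≤ a * x p + b * y p

  -- Disks are represented by their centers.
  Disks : ℕ → Set
  Disks n = Fin n → Point

  module _ {n : ℕ} (D : Disks n) where

    Distinct : Set
    Distinct = Injective _≡_ _≈ₚ_ D

    AllIntersect : Line → Set
    AllIntersect L = ∀ i → unitDisk (D i) ≬ onLine L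

    CentersOnOneSide : Line → Set
    CentersOnOneSide L = (∀ i → halfPlane₁ L (D i)) ⊎ (∀ i → halfPlane₂ L (D i))

    intersectionGraph : Graph
    intersectionGraph = record
      { Vertex = Fin n
      ; Adj    = λ i j → i ≢ j × unitDisk (D i) ≬ unitDisk (D j)
      ; symm   = λ { (i≢j , p , p∈i , p∈j) →
                     ≢-sym i≢j , p , p∈j , p∈i }
      ; irrefl = λ { (i≢i , _) → i≢i ≡.refl }
      }

    InducesBipartite : Subset n → Set
    InducesBipartite s = Bipartite (induced intersectionGraph (_∈ s))

    MaximumBipartite : Subset n → Set
    MaximumBipartite s =
      InducesBipartite s × (∀ t → InducesBipartite t → ∣ t ∣ ℕ.≤ ∣ s ∣)

-- A program acts on a real RAM, which has an array of words (natural numbers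
-- of bounded size) and an array of reals, both indexed by words.  Programs are
-- finite syntax without access to the ambient functions on ℕ or ℝ, so every
-- elementary operation is accounted for.

data WordExp : Set where
  lit         : ℕ → WordExp
  word[_]     : WordExp → WordExp
  _+ʷ_ _∸ʷ_ _*ʷ_ : WordExp → WordExp → WordExp

data RealExp : Set where
  0ʳ 1ʳ               : RealExp
  real[_]             : WordExp → RealExp
  _+ʳ_ _-ʳ_ _*ʳ_ _÷ʳ_ : RealExp → RealExp → RealExp

data Test : Set where
  _≤ʷ_ : WordExp → WordExp → Test
  _≤ʳ_ : RealExp → RealExp → Test
  notᵗ : Test → Test
  _∧ᵗ_ : Test → Test → Test

data Program : Set where
  skip      : Program
  word[_]≔_ : WordExp → WordExp → Program
  real[_]≔_ : WordExp → RealExp → Program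
  _⨾_       : Program → Program → Program
  if        : Test → Program → Program → Program
  while     : Test → Program → Program

infixl 7 _*ʷ_ _*ʳ_ _÷ʳ_
infixl 6 _+ʷ_ _∸ʷ_ _+ʳ_ _-ʳ_
infix  5 _≤ʷ_ _≤ʳ_
infixr 4 _∧ᵗ_
infix  4 word[_]≔_ real[_]≔_
infixr 3 _⨾_

-- Unit cost for every constant, memory access, arithmetic operation,
-- comparison and connective.

costʷ : WordExp → ℕ
costʷ (lit _)   = 1
costʷ word[ e ] = suc (costʷ e)
costʷ (e +ʷ f)  = suc (costʷ e ℕ.+ costʷ f)
costʷ (e ∸ʷ f)  = suc (costʷ e ℕ.+ costʷ f)
costʷ (e *ʷ f)  = suc (costʷ e ℕ.+ costʷ f)

costʳ : RealExp → ℕ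
costʳ 0ʳ        = 1
costʳ 1ʳ        = 1
costʳ real[ e ] = suc (costʷ e)
costʳ (e +ʳ f)  = suc (costʳ e ℕ.+ costʳ f)
costʳ (e -ʳ f)  = suc (costʳ e ℕ.+ costʳ f)
costʳ (e *ʳ f)  = suc (costʳ e ℕ.+ costʳ f)
costʳ (e ÷ʳ f)  = suc (costʳ e ℕ.+ costʳ f)

costᵗ : Test → ℕ
costᵗ (e ≤ʷ f) = suc (costʷ e ℕ.+ costʷ f)
costᵗ (e ≤ʳ f) = suc (costʳ e ℕ.+ costʳ f)
costᵗ (notᵗ t) = suc (costᵗ t)
costᵗ (t ∧ᵗ u) = suc (costᵗ t ℕ.+ costᵗ u)

-- A machine with S words and S reals of memory.  A word takes values below S,
-- just enough to address the whole memory, so large integers cannot be used to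
-- evade the space bound.  Evaluation yields nothing on word overflow and on division by zero; the execution relation
-- then has no rule, so a faulting program does not halt.

module RealRAM (ℝ : RealNumbers) (S : ℕ) where
  open RealNumbers ℝ

  Word : Set
  Word = Fin S

  record Memory : Set where
    constructor mem
    field
      words : Vec Word S
      reals : Vec Carrier S

  open Memory public

  toWord : ℕ → Maybe Word
  toWord v = Maybe.map (λ v<S → fromℕ< v<S) (dec⇒maybe (v ℕ.<? S))

  evalʷ : Memory → WordExp → Maybe Word
  evalʷ σ (lit v)   = toWord v
  evalʷ σ word[ e ] = Maybe.map (lookup (words σ)) (evalʷ σ e)
  evalʷ σ (e +ʷ f)  = evalʷ σ e >>= λ v → evalʷ σ f >>= λ w → toWord (toℕ v ℕ.+ toℕ w)
  evalʷ σ (e ∸ʷ f)  = evalʷ σ e >>= λ v → evalʷ σ f >>= λ w → toWord (toℕ v ℕ.∸ toℕ w)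
  evalʷ σ (e *ʷ f)  = evalʷ σ e >>= λ v → evalʷ σ f >>= λ w → toWord (toℕ v ℕ.* toℕ w)

  divide : Carrier → Carrier → Maybe Carrier
  divide r s with s ≟ 0#
  ... | yes _ = nothing
  ... | no  _ = just (r * s ⁻¹)

  evalʳ : Memory → RealExp → Maybe Carrier
  evalʳ σ 0ʳ        = just 0#
  evalʳ σ 1ʳ        = just 1#
  evalʳ σ real[ e ] = Maybe.map (lookup (reals σ)) (evalʷ σ e)
  evalʳ σ (e +ʳ f)  = Maybe.zipWith _+_ (evalʳ σ e) (evalʳ σ f)
  evalʳ σ (e -ʳ f)  = Maybe.zipWith (λ r s → r + - s) (evalʳ σ e) (evalʳ σ f)
  evalʳ σ (e *ʳ f)  = Maybe.zipWith _*_ (evalʳ σ e) (evalʳ σ f)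
  evalʳ σ (e ÷ʳ f)  = evalʳ σ e >>= λ r → evalʳ σ f >>= λ s → divide r s

  evalᵗ : Memory → Test → Maybe Bool
  evalᵗ σ (e ≤ʷ f) = Maybe.zipWith (λ v w → does (toℕ v ℕ.≤? toℕ w)) (evalʷ σ e) (evalʷ σ f)
  evalᵗ σ (e ≤ʳ f) = Maybe.zipWith (λ r s → does (r ≤? s)) (evalʳ σ e) (evalʳ σ f)
  evalᵗ σ (notᵗ t) = Maybe.map not (evalᵗ σ t)
  evalᵗ σ (t ∧ᵗ u) = Maybe.zipWith _∧_ (evalᵗ σ t) (evalᵗ σ u)

  infix 2 ⟨_,_⟩⇓_taking_

  -- ⟨ p , σ ⟩⇓ σ′ taking t: started in σ, p halts in σ′ after exactly t
  -- elementary operations.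
  data ⟨_,_⟩⇓_taking_ : Program → Memory → Memory → ℕ → Set where

    skip⇓ : ∀ {σ} → ⟨ skip , σ ⟩⇓ σ taking 1

    word⇓ : ∀ {σ e f a v} → evalʷ σ e ≡ just a → evalʷ σ f ≡ just v →
            ⟨ word[ e ]≔ f , σ ⟩⇓ mem (words σ [ a ]≔ v) (reals σ)
              taking suc (costʷ e ℕ.+ costʷ f)

    real⇓ : ∀ {σ e f a r} → evalʷ σ e ≡ just a → evalʳ σ f ≡ just r →
            ⟨ real[ e ]≔ f , σ ⟩⇓ mem (words σ) (reals σ [ a ]≔ r)
              taking suc (costʷ e ℕ.+ costʳ f)

    seq⇓ : ∀ {p q σ σ′ σ″ t u} →
           ⟨ p , σ ⟩⇓ σ′ taking t → ⟨ q , σ′ ⟩⇓ σ″ taking u →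
           ⟨ p ⨾ q , σ ⟩⇓ σ″ taking t ℕ.+ u

    if-true⇓ : ∀ {b p q σ σ′ t} → evalᵗ σ b ≡ just true →
               ⟨ p , σ ⟩⇓ σ′ taking t →
               ⟨ if b p q , σ ⟩⇓ σ′ taking suc (costᵗ b ℕ.+ t)

    if-false⇓ : ∀ {b p q σ σ′ t} → evalᵗ σ b ≡ just false →
                ⟨ q , σ ⟩⇓ σ′ taking t →
                ⟨ if b p q , σ ⟩⇓ σ′ taking suc (costᵗ b ℕ.+ t)

    while-true⇓ : ∀ {b p σ σ′ σ″ t u} → evalᵗ σ b ≡ just true →
                  ⟨ p , σ ⟩⇓ σ′ taking t → ⟨ while b p , σ′ ⟩⇓ σ″ taking u →
                  ⟨ while b p , σ ⟩⇓ σ″ taking suc (costᵗ b ℕ.+ (t ℕ.+ u))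

    while-false⇓ : ∀ {b p σ} → evalᵗ σ b ≡ just false →
                   ⟨ while b p , σ ⟩⇓ σ taking suc (costᵗ b)

-- A line and n centers are described by this many reals.
inputSize : ℕ → ℕ
inputSize n = 3 ℕ.+ (n ℕ.+ n)

module InputOutput (ℝ : RealNumbers) (n : ℕ) {S : ℕ} (fits : inputSize n ℕ.≤ S) where
  open RealNumbers ℝ
  open Plane ℝ
  open RealRAM ℝ S

  n<S : n ℕ.< S
  n<S = ℕ.≤-trans (s≤s (ℕ.≤-trans (ℕ.m≤m+n n n) (ℕ.m≤n+m (n ℕ.+ n) 2))) fits

  0<S : 0 ℕ.< S
  0<S = ℕ.≤-trans (s≤s z≤n) n<S

  -- Word 0 holds n; the reals hold the coefficients of the line, then the
  -- abscissae and then the ordinates of the centers; all other cells are zero.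
  initial : Line → Disks n → Memory
  initial L D = mem
    (padRight 0<S (fromℕ< 0<S) (fromℕ< n<S ∷ []))
    (padRight fits 0# (a ∷ b ∷ c ∷ (tabulate (λ i → x (D i)) ++ tabulate (λ i → y (D i)))))
    where open Line L

  -- Disk i is selected when word i is nonzero.
  output : Memory → Subset n
  output σ = tabulate λ i → does (1 ℕ.≤? toℕ (lookup (words σ) (inject≤ i (ℕ.<⇒≤ n<S))))

-- The centers lie in a strip of width 1 along L, so two disjoint disks are
-- more than √3 apart along L.  Hence two consecutive gaps exceed the distance 2
-- of touching disks, and disjointness is transitive along L: the independent
-- sets of the intersection graph are the chains of a partial order ≺, and the
-- sets inducing a bipartite subgraph are the unions of two chains.  A union
-- with r + 1 disks, built from left to right, arises by putting its last disk m
-- on one of the chains of a union with r disks; whether this is possible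
-- depends only on the tops k and l of the two chains.  Tabulating the reachable
-- (r , k , l) takes one test per (r , k , l , m), and a largest union is read
-- off by tracing the table backwards.

module Submission where

open import Algebra.Bundles using (CommutativeRing; RawRing)
import Algebra.Solver.Ring
open import Algebra.Solver.Ring.AlmostCommutativeRing
  using (fromCommutativeRing; _-Raw-AlmostCommutative⟶_)
open import Data.Bool.Base using (Bool; true; false; not; if_then_else_)
import Data.Bool.Properties as Bool
open import Data.Empty using (⊥-elim)
open import Data.Fin.Base
  using (Fin; zero; suc; toℕ; fromℕ; inject₁; fromℕ<; inject≤; combine; splitAt; _↑ˡ_; _↑ʳ_)
open import Data.Fin.Patterns
import Data.Fin.Properties as Fin
open import Data.Fin.Subset using (Subset; _∈_; _∉_; ∣_∣; inside; outside) renaming (⊥ to ∅)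
open import Data.Fin.Subset.Properties using (Empty-unique; ∉⊥; ∣⊥∣≡0; ∣p∣≤n; _∈?_)
open import Data.Maybe.Base using (Maybe; just; nothing)
open import Data.Nat.Base as ℕ using (ℕ; zero; suc; z≤n; s≤s)
import Data.Nat.Properties as ℕ
open import Data.Product.Base using (Σ-syntax; ∃-syntax; _×_; _,_; proj₁; proj₂)
open import Data.Product.Properties using (≡-dec)
open import Data.Sum.Base as Sum using (_⊎_; inj₁; inj₂; [_,_]′)
open import Data.Unit.Base using (⊤; tt)
open import Data.Vec.Base
  using (Vec; []; _∷_; _++_; lookup; tabulate; padRight; _[_]≔_; here; there)
open import Data.Vec.Properties
  using ([]=⇒lookup; lookup⇒[]=; lookup∘update; lookup∘update′; lookup∘tabulate; tabulate∘lookup;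
         tabulate-cong; lookup-++ˡ; lookup-++ʳ; lookup-replicate)
open import Function.Base using (_∘_)
open import Level using (0ℓ)
open import Relation.Binary.Definitions using (DecidableEquality)
open import Relation.Binary.PropositionalEquality as ≡ using (_≡_; _≢_; ≢-sym)
open import Relation.Binary.Structures using (IsDecTotalOrder)
open import Relation.Nullary using (Dec; ¬_; yes; no; does; ¬?; _×-dec_)
open import Relation.Nullary.Decidable
  using (map′; decidable-stable; dec-true; dec-false; dec-yes-irr)
open import Relation.Unary using (_≬_)
open import Defs

-- Square roots are avoided: positions along and across the line are the linear forms `key` and
-- `level`, both scaled by the square root of `norm`. Each geometric claim then compares
-- polynomials, and an identity exhibits the difference of its sides as a sum of nonnegative terms.
--
-- Keys may tie, so left to right is only a total preorder. The new disk is therefore required to be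
-- weakly after the other top and distinct from it; distinctness keeps a disk from being used on
-- both chains. On its own chain the relation is strict and transitive, so comparing with the top
-- compares with the whole chain.
--
-- An entry needs to record only the disk below the last one: that disk, the other top and the size
-- fix the preceding state up to the order of its two tops, which is why states are looked up in
-- both orders.
--
-- The program is one text for all `n`, and no intermediate word may reach the memory size. So
-- addresses are computed from word 0, which must keep `n` until the end, and every evaluation
-- carries an overflow bound.

-- A ring solver with integer coefficients

-- The pair (m , k) stands for the integer m − k.
module IntegerCoefficients {c ℓ} (R : CommutativeRing c ℓ) where
  open CommutativeRing R
  open import Algebra.Properties.Ring ring using (-‿distribˡ-*; -‿distribʳ-*)
  open import Algebra.Properties.AbelianGroup +-abelianGroup
    using (⁻¹-∙-comm; ⁻¹-involutive; ε⁻¹≈ε; ∙-cancelʳ)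
  open import Algebra.Properties.CommutativeSemigroup +-commutativeSemigroup
    using (interchange)
  open import Algebra.Properties.Semiring.Mult.TCOptimised semiring
    using (×-homo-+; ×1-homo-*) renaming (_×_ to _×′_)
  open import Relation.Binary.Reasoning.Setoid setoid

  ι : ℕ → Carrier
  ι m = m ×′ 1#

  -- Cancelling makes equal integers definitionally equal, which the solver
  -- needs when it compares normal forms.
  ⟦_⟧ : ℕ × ℕ → Carrier
  ⟦ m       , 0       ⟧ = ι m
  ⟦ 0       , ℕ.suc k ⟧ = - ι (ℕ.suc k)
  ⟦ ℕ.suc m , ℕ.suc k ⟧ = ⟦ m , k ⟧

  telescope : ∀ x y z → (x + - y) + (y + z) ≈ x + z
  telescope x y z = begin
    (x + - y) + (y + z)    ≈⟨ +-assoc _ _ _ ⟩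
    x + (- y + (y + z))    ≈⟨ +-congˡ (+-assoc _ _ _) ⟨
    x + (- y + y + z)      ≈⟨ +-congˡ (+-congʳ (-‿inverseˡ y)) ⟩
    x + (0# + z)           ≈⟨ +-congˡ (+-identityˡ z) ⟩
    x + z                  ∎

  ⟦⟧-difference : ∀ m k → ⟦ m , k ⟧ ≈ ι m + - ι k
  ⟦⟧-difference m         0         = sym (trans (+-congˡ ε⁻¹≈ε) (+-identityʳ _))
  ⟦⟧-difference 0         (ℕ.suc k) = sym (+-identityˡ _)
  ⟦⟧-difference (ℕ.suc m) (ℕ.suc k) = begin
    ⟦ m , k ⟧                              ≈⟨ ⟦⟧-difference m k ⟩
    ι m + - ι k                            ≈⟨ telescope (ι m) (- 1#) (- ι k) ⟨
    (ι m + - - 1#) + (- 1# + - ι k)        ≈⟨ +-cong (+-congˡ (⁻¹-involutive 1#)) (⁻¹-∙-comm 1# (ι k)) ⟩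
    (ι m + 1#) + - (1# + ι k)              ≈⟨ +-cong (+-comm (ι m) 1#) refl ⟩
    (1# + ι m) + - (1# + ι k)              ≈⟨ +-cong (×-homo-+ 1# 1 m) (-‿cong (×-homo-+ 1# 1 k)) ⟨
    ι (ℕ.suc m) + - ι (ℕ.suc k)            ∎

  coefficients : RawRing 0ℓ 0ℓ
  coefficients = record
    { Carrier = ℕ × ℕ
    ; _≈_     = _≡_
    ; _+_     = λ (m , k) (m′ , k′) → m ℕ.+ m′ , k ℕ.+ k′
    ; _*_     = λ (m , k) (m′ , k′) → m ℕ.* m′ ℕ.+ k ℕ.* k′ , m ℕ.* k′ ℕ.+ k ℕ.* m′
    ; -_      = λ (m , k) → k , m
    ; 0#      = 0 , 0
    ; 1#      = 1 , 0
    }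

  +-homo : ∀ m k m′ k′ → ⟦ m ℕ.+ m′ , k ℕ.+ k′ ⟧ ≈ ⟦ m , k ⟧ + ⟦ m′ , k′ ⟧
  +-homo m k m′ k′ = begin
    ⟦ m ℕ.+ m′ , k ℕ.+ k′ ⟧                ≈⟨ ⟦⟧-difference (m ℕ.+ m′) (k ℕ.+ k′) ⟩
    ι (m ℕ.+ m′) + - ι (k ℕ.+ k′)          ≈⟨ +-cong (×-homo-+ 1# m m′) (-‿cong (×-homo-+ 1# k k′)) ⟩
    (ι m + ι m′) + - (ι k + ι k′)          ≈⟨ +-congˡ (⁻¹-∙-comm (ι k) (ι k′)) ⟨
    (ι m + ι m′) + (- ι k + - ι k′)        ≈⟨ interchange _ _ _ _ ⟩
    (ι m + - ι k) + (ι m′ + - ι k′)        ≈⟨ +-cong (⟦⟧-difference m k) (⟦⟧-difference m′ k′) ⟨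
    ⟦ m , k ⟧ + ⟦ m′ , k′ ⟧                ∎

  *-homo : ∀ m k m′ k′ →
           ⟦ m ℕ.* m′ ℕ.+ k ℕ.* k′ , m ℕ.* k′ ℕ.+ k ℕ.* m′ ⟧ ≈ ⟦ m , k ⟧ * ⟦ m′ , k′ ⟧
  *-homo m k m′ k′ = begin
    ⟦ m ℕ.* m′ ℕ.+ k ℕ.* k′ , m ℕ.* k′ ℕ.+ k ℕ.* m′ ⟧
      ≈⟨ ⟦⟧-difference (m ℕ.* m′ ℕ.+ k ℕ.* k′) (m ℕ.* k′ ℕ.+ k ℕ.* m′) ⟩
    ι (m ℕ.* m′ ℕ.+ k ℕ.* k′) + - ι (m ℕ.* k′ ℕ.+ k ℕ.* m′)
      ≈⟨ +-cong (ι-sum m m′ k k′) (trans (-‿cong (ι-sum m k′ k m′)) (sym (⁻¹-∙-comm _ _))) ⟩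
    (ι m * ι m′ + ι k * ι k′) + (- (ι m * ι k′) + - (ι k * ι m′))
      ≈⟨ interchange _ _ _ _ ⟩
    (ι m * ι m′ + - (ι m * ι k′)) + (ι k * ι k′ + - (ι k * ι m′))
      ≈⟨ +-cong (+-congˡ (-‿distribʳ-* _ _))
                 (trans (+-comm _ _) (+-cong (-‿distribˡ-* _ _) minus-minus)) ⟩
    (ι m * ι m′ + ι m * - ι k′) + (- ι k * ι m′ + - ι k * - ι k′)
      ≈⟨ +-cong (distribˡ _ _ _) (distribˡ _ _ _) ⟨
    ι m * (ι m′ + - ι k′) + - ι k * (ι m′ + - ι k′)
      ≈⟨ distribʳ _ _ _ ⟨
    (ι m + - ι k) * (ι m′ + - ι k′)
      ≈⟨ *-cong (⟦⟧-difference m k) (⟦⟧-difference m′ k′) ⟨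
    ⟦ m , k ⟧ * ⟦ m′ , k′ ⟧ ∎
    where
    ι-sum : ∀ i j i′ j′ → ι (i ℕ.* j ℕ.+ i′ ℕ.* j′) ≈ ι i * ι j + ι i′ * ι j′
    ι-sum i j i′ j′ =
      trans (×-homo-+ 1# (i ℕ.* j) (i′ ℕ.* j′)) (+-cong (×1-homo-* i j) (×1-homo-* i′ j′))

    minus-minus : ι k * ι k′ ≈ - ι k * - ι k′
    minus-minus = begin
      ι k * ι k′           ≈⟨ ⁻¹-involutive _ ⟨
      - (- (ι k * ι k′))   ≈⟨ -‿cong (-‿distribˡ-* _ _) ⟩
      - (- ι k * ι k′)     ≈⟨ -‿distribʳ-* _ _ ⟩
      - ι k * - ι k′       ∎

  -‿homo : ∀ m k → ⟦ k , m ⟧ ≈ - ⟦ m , k ⟧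
  -‿homo m k = begin
    ⟦ k , m ⟧            ≈⟨ ⟦⟧-difference k m ⟩
    ι k + - ι m          ≈⟨ +-comm _ _ ⟩
    - ι m + ι k          ≈⟨ +-congˡ (⁻¹-involutive _) ⟨
    - ι m + - (- ι k)    ≈⟨ ⁻¹-∙-comm _ _ ⟩
    - (ι m + - ι k)      ≈⟨ -‿cong (⟦⟧-difference m k) ⟨
    - ⟦ m , k ⟧          ∎

  homomorphism : coefficients -Raw-AlmostCommutative⟶ fromCommutativeRing R
  homomorphism = record
    { ⟦_⟧    = ⟦_⟧
    ; +-homo = λ (m , k) (m′ , k′) → +-homo m k m′ k′
    ; *-homo = λ (m , k) (m′ , k′) → *-homo m k m′ k′
    ; -‿homo = λ (m , k) → -‿homo m k
    ; 0-homo = refl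
    ; 1-homo = refl
    }

  -- Pairs that denote the same integer need not be equal, so coefficients are compared by cross
  -- sums; adding `ι k + ι k′` to both sides removes the subtractions.
  ⟦⟧-≡ : ∀ m k m′ k′ → m ℕ.+ k′ ≡ m′ ℕ.+ k → ⟦ m , k ⟧ ≈ ⟦ m′ , k′ ⟧
  ⟦⟧-≡ m k m′ k′ eq = ∙-cancelʳ (ι k + ι k′) _ _ (begin
    ⟦ m , k ⟧ + (ι k + ι k′)             ≈⟨ +-congʳ (⟦⟧-difference m k) ⟩
    (ι m + - ι k) + (ι k + ι k′)         ≈⟨ telescope (ι m) (ι k) (ι k′) ⟩
    ι m + ι k′                           ≈⟨ ×-homo-+ 1# m k′ ⟨
    ι (m ℕ.+ k′)                         ≡⟨ ≡.cong ι eq ⟩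
    ι (m′ ℕ.+ k)                         ≈⟨ ×-homo-+ 1# m′ k ⟩
    ι m′ + ι k                           ≈⟨ telescope (ι m′) (ι k′) (ι k) ⟨
    (ι m′ + - ι k′) + (ι k′ + ι k)       ≈⟨ +-cong (⟦⟧-difference m′ k′) (+-comm (ι k) (ι k′)) ⟨
    ⟦ m′ , k′ ⟧ + (ι k + ι k′)           ∎)

  _≟ᶜ_ : ∀ p q → Maybe (⟦ p ⟧ ≈ ⟦ q ⟧)
  (m , k) ≟ᶜ (m′ , k′) with m ℕ.+ k′ ℕ.≟ m′ ℕ.+ k
  ... | yes eq = just (⟦⟧-≡ m k m′ k′ eq)
  ... | no _   = nothing

  open Algebra.Solver.Ring coefficients (fromCommutativeRing R) homomorphism _≟ᶜ_ public
    using (solve; _:=_; _:+_; _:*_; :-_; con; Polynomial)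

-- Ordered field inequalities and distances between centers

module Geometry (ℝ : RealNumbers) where
  open RealNumbers ℝ
  open Plane ℝ
  open IntegerCoefficients commutativeRing
    using (solve; _:=_; _:+_; _:*_; :-_; con; Polynomial)

  :sq : ∀ {k} → Polynomial k → Polynomial k
  :sq p = p :* p

  :1 : ∀ {k} → Polynomial k
  :1 = con (1 , 0)

  :2 : ∀ {k} → Polynomial k
  :2 = :1 :+ :1

  open IsDecTotalOrder isDecTotalOrder
    using (total; antisym; ≤-respˡ-≈; ≤-respʳ-≈)
    renaming (refl to ≤-refl; trans to ≤-trans)

  -- Spelled as the real expression by which the program forms this constant, so that the two agree
  -- by computation.
  4# : Carrier
  4# = (1# + 1#) * (1# + 1#)

  ≤⇒0≤ : ∀ {x y} → x ≤ y → 0# ≤ y + - x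
  ≤⇒0≤ {x} x≤y = ≤-respˡ-≈ (-‿inverseʳ x) (+-monoˡ-≤ (- x) x≤y)

  -- Every inequality below is certified by a nonnegative expression for the
  -- difference of its sides.
  certify : ∀ {x y e} → 0# ≤ e → e ≈ y + - x → x ≤ y
  certify {x} {y} {e} 0≤e e≈y-x =
    ≤-respˡ-≈ (+-identityˡ x)
      (≤-respʳ-≈ (trans (+-congʳ e≈y-x) (solve 2 (λ x y → (y :+ :- x) :+ x := y) refl x y))
        (+-monoˡ-≤ x 0≤e))

  infixl 6 _⊕_
  _⊕_ : ∀ {x y} → 0# ≤ x → 0# ≤ y → 0# ≤ x + y
  _⊕_ {x} {y} 0≤x 0≤y = ≤-trans 0≤y (≤-respˡ-≈ (+-identityˡ y) (+-monoˡ-≤ y 0≤x))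

  0≤-x : ∀ {x} → x ≤ 0# → 0# ≤ - x
  0≤-x {x} x≤0 = ≤-respʳ-≈ (+-identityˡ (- x)) (≤⇒0≤ x≤0)

  0≤sq : ∀ x → 0# ≤ sq x
  0≤sq x with total 0# x
  ... | inj₁ 0≤x = *-nonNeg 0≤x 0≤x
  ... | inj₂ x≤0 = ≤-respʳ-≈ (solve 1 (λ x → :- x :* :- x := x :* x) refl x)
                     (*-nonNeg (0≤-x x≤0) (0≤-x x≤0))

  sq≤0⇒≈0 : ∀ {x} → sq x ≤ 0# → x ≈ 0#
  sq≤0⇒≈0 {x} x²≤0 with x ≟ 0#
  ... | yes x≈0 = x≈0
  ... | no  x≉0 = begin
    x                    ≈⟨ *-identityʳ x ⟨
    x * 1#               ≈⟨ *-congˡ (*-inverseʳ x x≉0) ⟨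
    x * (x * x ⁻¹)       ≈⟨ *-assoc _ _ _ ⟨
    x * x * x ⁻¹         ≈⟨ *-congʳ (antisym x²≤0 (0≤sq x)) ⟩
    0# * x ⁻¹            ≈⟨ zeroˡ _ ⟩
    0#                   ∎
    where open import Relation.Binary.Reasoning.Setoid setoid

  0≤1 : 0# ≤ 1#
  0≤1 = ≤-respʳ-≈ (*-identityʳ 1#) (0≤sq 1#)

  2≉0 : ¬ 1# + 1# ≈ 0#
  2≉0 2≈0 = 0≉1 (antisym 0≤1 (certify 0≤1
    (trans (solve 0 (:1 := (:1 :+ :1) :+ :- :1) refl) (+-congʳ 2≈0))))

  dist² : Point → Point → Carrier
  dist² p q = (x p + - x q) * (x p + - x q) + (y p + - y q) * (y p + - y q)

  -- Parallelogram law: twice the sum of the squared distances from `r` to the two centers is the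
  -- squared distance of the centers plus a square.
  meet⇒dist²≤4 : ∀ p q → unitDisk p ≬ unitDisk q → dist² p q ≤ 4#
  meet⇒dist²≤4 p q (r , r∈p , r∈q) = certify
    (≤⇒0≤ r∈p ⊕ ≤⇒0≤ r∈p ⊕ (≤⇒0≤ r∈q ⊕ ≤⇒0≤ r∈q)
      ⊕ 0≤sq ((x r + - x p) + (x r + - x q)) ⊕ 0≤sq ((y r + - y p) + (y r + - y q)))
    (solve 6 (λ px py qx qy rx ry →
        let P = :1 :+ :- (:sq (rx :+ :- px) :+ :sq (ry :+ :- py))
            Q = :1 :+ :- (:sq (rx :+ :- qx) :+ :sq (ry :+ :- qy)) in
        P :+ P :+ (Q :+ Q) :+ :sq ((rx :+ :- px) :+ (rx :+ :- qx))
          :+ :sq ((ry :+ :- py) :+ (ry :+ :- qy))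
        := :2 :* :2 :+ :- (:sq (px :+ :- qx) :+ :sq (py :+ :- qy)))
      refl (x p) (y p) (x q) (y q) (x r) (y r))

  -- The midpoint of the centers is a common point; its squared distance to either center is a
  -- quarter of `dist² p q`.
  dist²≤4⇒meet : ∀ p q → dist² p q ≤ 4# → unitDisk p ≬ unitDisk q
  dist²≤4⇒meet p q d≤4 = ⟨ h * (x p + x q) , h * (y p + y q) ⟩ , near-p , near-q
    where
    h = (1# + 1#) ⁻¹
    1≈2h : 1# ≈ (1# + 1#) * h
    1≈2h = sym (*-inverseʳ (1# + 1#) 2≉0)

    near : ∀ (r s : Point) → 0# ≤ 4# + - dist² r s →
           sq (h * (x r + x s) + - x r) + sq (h * (y r + y s) + - y r) ≤ 1#
    -- The solver sees `h` as a variable, so the identity is first made homogeneous in `h`;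
    -- afterwards `1#` replaces `(1# + 1#) * h`.
    near r s 0≤4-d = certify (*-nonNeg (0≤sq h) 0≤4-d) (begin
      sq h * (4# + - dist² r s)
        ≈⟨ solve 5 (λ h rx ry sx sy →
             :sq h :* (:2 :* :2 :+ :- (:sq (rx :+ :- sx) :+ :sq (ry :+ :- sy))) :=
             :sq (:2 :* h) :+ :- (:sq (h :* (rx :+ sx) :+ :- ((:2 :* h) :* rx)) :+
                                  :sq (h :* (ry :+ sy) :+ :- ((:2 :* h) :* ry))))
             refl h (x r) (y r) (x s) (y s) ⟩
      sq ((1# + 1#) * h) + - (sq (h * (x r + x s) + - ((1# + 1#) * h * x r)) +
                              sq (h * (y r + y s) + - ((1# + 1#) * h * y r)))
        ≈⟨ +-cong (trans (*-cong (sym 1≈2h) (sym 1≈2h)) (*-identityʳ 1#))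
                  (-‿cong (+-cong (sq-cong (+-congˡ (-‿cong (drop (x r)))))
                                  (sq-cong (+-congˡ (-‿cong (drop (y r))))))) ⟩
      1# + - (sq (h * (x r + x s) + - x r) + sq (h * (y r + y s) + - y r)) ∎)
      where
      open import Relation.Binary.Reasoning.Setoid setoid
      sq-cong : ∀ {u v} → u ≈ v → sq u ≈ sq v
      sq-cong u≈v = *-cong u≈v u≈v
      drop : ∀ z → (1# + 1#) * h * z ≈ z
      drop z = trans (*-congʳ (sym 1≈2h)) (*-identityˡ z)

    near-p = near p q (≤⇒0≤ d≤4)
    near-q = ≤-respˡ-≈
      (solve 5 (λ h px py qx qy →
          :sq (h :* (qx :+ px) :+ :- qx) :+ :sq (h :* (qy :+ py) :+ :- qy) :=
          :sq (h :* (px :+ qx) :+ :- qx) :+ :sq (h :* (py :+ qy) :+ :- qy))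
        refl h (x p) (y p) (x q) (y q))
      (near q p (≤-respʳ-≈
        (solve 4 (λ px py qx qy →
            :2 :* :2 :+ :- (:sq (px :+ :- qx) :+ :sq (py :+ :- qy)) :=
            :2 :* :2 :+ :- (:sq (qx :+ :- px) :+ :sq (qy :+ :- py)))
          refl (x p) (y p) (x q) (y q))
        (≤⇒0≤ d≤4)))

  -- The strip along the line and the order of the disks

  module Strip {n : ℕ} (D : Disks n) (L : Line)
               (intersects : AllIntersect D L) (oneSided : CentersOnOneSide D L) where
    open Line L

    norm : Carrier
    norm = a * a + b * b

    -- Orthogonal coordinates, scaled by √norm: key along L, level across L.
    key level : Point → Carrier
    key p   = b * x p + - (a * y p)
    level p = a * x p + b * y p

    0≤norm : 0# ≤ norm
    0≤norm = 0≤sq a ⊕ 0≤sq b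

    -- The coefficients of the line do not both vanish. The refutations below all end in this
    -- contradiction.
    norm≰0 : ¬ 0# ≤ - norm
    norm≰0 0≤-norm = nondegenerate
      ( sq≤0⇒≈0 (certify (0≤-norm ⊕ 0≤sq b)
          (solve 2 (λ a b → :- (:sq a :+ :sq b) :+ :sq b := con (0 , 0) :+ :- :sq a) refl a b))
      , sq≤0⇒≈0 (certify (0≤-norm ⊕ 0≤sq a)
          (solve 2 (λ a b → :- (:sq a :+ :sq b) :+ :sq a := con (0 , 0) :+ :- :sq b) refl a b)))

    -- Lagrange's identity: `norm` times the squared distance from the center to `p` is the sum of
    -- the squared differences of `level` and of `key`; the latter is dropped.
    level² : ∀ i → 0# ≤ norm + - sq (level (D i) + - c)
    level² i with intersects i
    ... | p , p∈i , p∈L = ≤-respʳ-≈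
      (trans
        (solve 6 (λ a b px py x y →
            (:sq a :+ :sq b) :* (:1 :+ :- (:sq (px :+ :- x) :+ :sq (py :+ :- y)))
              :+ :sq (b :* (px :+ :- x) :+ :- (a :* (py :+ :- y))) :=
            (:sq a :+ :sq b) :+ :- :sq ((a :* x :+ b :* y) :+ :- (a :* px :+ b :* py)))
          refl a b (x p) (y p) (x (D i)) (y (D i)))
        (+-congˡ (-‿cong (*-cong l≈ l≈))))
      (*-nonNeg 0≤norm (≤⇒0≤ p∈i) ⊕ 0≤sq (b * (x p + - x (D i)) + - (a * (y p + - y (D i)))))
      where
      l≈ : level (D i) + - level p ≈ level (D i) + - c
      l≈ = +-congˡ (-‿cong p∈L)

    -- The difference of two nonnegative numbers is at most the larger one in absolute value. This
    -- is what one-sidedness buys: for centers on both sides of the line, levels could differ by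
    -- twice as much.
    gap² : ∀ g h → 0# ≤ g → 0# ≤ h → 0# ≤ norm + - sq g → 0# ≤ norm + - sq h →
           0# ≤ norm + - sq (g + - h)
    gap² g h 0≤g 0≤h g² h² with total h g
    ... | inj₁ h≤g = ≤-respʳ-≈
      (solve 3 (λ N g h → (N :+ :- :sq g) :+ h :* ((g :+ :- h) :+ g) := N :+ :- :sq (g :+ :- h))
        refl norm g h)
      (g² ⊕ *-nonNeg 0≤h (≤⇒0≤ h≤g ⊕ 0≤g))
    ... | inj₂ g≤h = ≤-respʳ-≈
      (solve 3 (λ N g h → (N :+ :- :sq h) :+ g :* ((h :+ :- g) :+ h) := N :+ :- :sq (g :+ :- h))
        refl norm g h)
      (h² ⊕ *-nonNeg 0≤g (≤⇒0≤ g≤h ⊕ 0≤h))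

    levelGap² : ∀ i j → 0# ≤ norm + - sq (level (D i) + - level (D j))
    levelGap² i j = [ below , above ]′ oneSided
      where
      flip : ∀ i → 0# ≤ norm + - sq (c + - level (D i))
      flip i = ≤-respʳ-≈
        (solve 3 (λ N u c → N :+ :- :sq (u :+ :- c) := N :+ :- :sq (c :+ :- u))
          refl norm (level (D i)) c)
        (level² i)

      below : (∀ i → halfPlane₁ L (D i)) → 0# ≤ norm + - sq (level (D i) + - level (D j))
      below l≤c = ≤-respʳ-≈
        (solve 4 (λ N u v c → N :+ :- :sq ((c :+ :- u) :+ :- (c :+ :- v)) := N :+ :- :sq (u :+ :- v))
          refl norm (level (D i)) (level (D j)) c)
        (gap² (c + - level (D i)) (c + - level (D j)) (≤⇒0≤ (l≤c i)) (≤⇒0≤ (l≤c j)) (flip i) (flip j))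

      above : (∀ i → halfPlane₂ L (D i)) → 0# ≤ norm + - sq (level (D i) + - level (D j))
      above c≤l = ≤-respʳ-≈
        (solve 4 (λ N u v c → N :+ :- :sq ((u :+ :- c) :+ :- (v :+ :- c)) := N :+ :- :sq (u :+ :- v))
          refl norm (level (D i)) (level (D j)) c)
        (gap² (level (D i) + - c) (level (D j) + - c) (≤⇒0≤ (c≤l i)) (≤⇒0≤ (c≤l j))
          (level² i) (level² j))

    infix 4 _⊑_ _≺_

    _⊑_ _≺_ : Fin n → Fin n → Set
    i ⊑ j = key (D i) ≤ key (D j)
    i ≺ j = i ⊑ j × ¬ dist² (D i) (D j) ≤ 4#

    -- By Lagrange's identity, at least 4 `norm` is shared by the squares of the key and level
    -- differences, and the level takes at most `norm` of it. The weak inequality is enough, since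
    -- transitivity has slack.
    keyGap² : ∀ {i j} → i ≺ j →
              0# ≤ sq (key (D j) + - key (D i)) + - (norm + norm + norm)
    keyGap² {i} {j} (_ , d≰4) with total (dist² (D i) (D j)) 4#
    ... | inj₁ d≤4 = ⊥-elim (d≰4 d≤4)
    ... | inj₂ 4≤d = ≤-respʳ-≈
      (solve 6 (λ a b x y x′ y′ →
          let N = :sq a :+ :sq b in
          N :* ((:sq (x :+ :- x′) :+ :sq (y :+ :- y′)) :+ :- (:2 :* :2))
            :+ (N :+ :- :sq ((a :* x :+ b :* y) :+ :- (a :* x′ :+ b :* y′))) :=
          :sq ((b :* x′ :+ :- (a :* y′)) :+ :- (b :* x :+ :- (a :* y))) :+ :- (N :+ N :+ N))
        refl a b (x (D i)) (y (D i)) (x (D j)) (y (D j)))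
      (*-nonNeg 0≤norm (≤⇒0≤ 4≤d) ⊕ levelGap² i j)

    -- The same identity, with the square of the level difference dropped.
    near-keyGap² : ∀ {i j} → dist² (D i) (D j) ≤ 4# →
                   0# ≤ norm + norm + norm + norm + - sq (key (D j) + - key (D i))
    near-keyGap² {i} {j} d≤4 = ≤-respʳ-≈
      (solve 6 (λ a b x y x′ y′ →
          let N = :sq a :+ :sq b in
          N :* (:2 :* :2 :+ :- (:sq (x :+ :- x′) :+ :sq (y :+ :- y′)))
            :+ :sq ((a :* x :+ b :* y) :+ :- (a :* x′ :+ b :* y′)) :=
          N :+ N :+ N :+ N :+ :- :sq ((b :* x′ :+ :- (a :* y′)) :+ :- (b :* x :+ :- (a :* y))))
        refl a b (x (D i)) (y (D i)) (x (D j)) (y (D j)))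
      (*-nonNeg 0≤norm (≤⇒0≤ d≤4) ⊕ 0≤sq (level (D i) + - level (D j)))

    ⊑-total : ∀ i j → i ⊑ j ⊎ j ⊑ i
    ⊑-total i j = total _ _

    ⊑-trans : ∀ {i j k} → i ⊑ j → j ⊑ k → i ⊑ k
    ⊑-trans = ≤-trans

    -- If both held, the keys would be equal and `keyGap²` would read 0 ≤ -3 `norm`.
    ≺⇒⋣ : ∀ {i j} → i ≺ j → ¬ j ⊑ i
    ≺⇒⋣ {i} {j} i≺j j⊑i = norm≰0 (≤-respʳ-≈
      (trans
        (+-congʳ (+-congʳ (+-congʳ (*-cong u≈0 u≈0))))
        (solve 1 (λ N → con (0 , 0) :* con (0 , 0) :+ :- (N :+ N :+ N) :+ N :+ N := :- N) refl norm))
      (keyGap² i≺j ⊕ 0≤norm ⊕ 0≤norm))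
      where
      u≈0 : key (D j) + - key (D i) ≈ 0#
      u≈0 = trans (+-congʳ (antisym j⊑i (proj₁ i≺j))) (-‿inverseʳ _)

    -- Both key gaps exceed √3 · √norm, so the sum of their squares exceeds the
    -- 4 norm that a pair of intersecting disks allows.
    ≺-trans : ∀ {i j k} → i ≺ j → j ≺ k → i ≺ k
    ≺-trans {i} {j} {k} i≺j j≺k = ≤-trans (proj₁ i≺j) (proj₁ j≺k) , λ d≤4 →
      norm≰0 (≤-respʳ-≈
        (solve 4 (λ N u v w →
            (N :+ N :+ N :+ N :+ :- :sq (w :+ :- u)) :+ (:sq (v :+ :- u) :+ :- (N :+ N :+ N))
              :+ (:sq (w :+ :- v) :+ :- (N :+ N :+ N))
              :+ ((v :+ :- u) :* (w :+ :- v) :+ (v :+ :- u) :* (w :+ :- v)) :+ N :=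
            :- N)
          refl norm (key (D i)) (key (D j)) (key (D k)))
        (near-keyGap² d≤4 ⊕ keyGap² i≺j ⊕ keyGap² j≺k ⊕ (0≤uv ⊕ 0≤uv) ⊕ 0≤norm))
      where
      0≤uv : 0# ≤ (key (D j) + - key (D i)) * (key (D k) + - key (D j))
      0≤uv = *-nonNeg (≤⇒0≤ (proj₁ i≺j)) (≤⇒0≤ (proj₁ j≺k))

    open Graph (intersectionGraph D) using (Adj)

    ≺⇒¬Adj : ∀ {i j} → i ≺ j → ¬ Adj i j
    ≺⇒¬Adj {i} {j} (_ , d≰4) (_ , meet) = d≰4 (meet⇒dist²≤4 (D i) (D j) meet)

    ¬Adj⇒≺ : ∀ {i j} → i ≢ j → ¬ Adj i j → i ⊑ j → i ≺ j
    ¬Adj⇒≺ {i} {j} i≢j ¬adj i⊑j = i⊑j , λ d≤4 → ¬adj (i≢j , dist²≤4⇒meet (D i) (D j) d≤4)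

open import Data.Nat.Base using (_+_; _*_; _∸_; _^_; _≤_; _<_)
open ≡ using (refl; sym; trans; cong; cong₂; subst; subst₂)

-- Point updates of functions and subsets

module Update {A : Set} (_≟_ : DecidableEquality A) where

  infixl 9 _[_↦_]

  _[_↦_] : (A → ℕ) → A → ℕ → A → ℕ
  (f [ a ↦ v ]) b = if does (a ≟ b) then v else f b

  update-same : ∀ f a v → (f [ a ↦ v ]) a ≡ v
  update-same f a v rewrite dec-true (a ≟ a) refl = refl

  update-other : ∀ f a v {b} → a ≢ b → (f [ a ↦ v ]) b ≡ f b
  update-other f a v {b} a≢b rewrite dec-false (a ≟ b) a≢b = refl

∣∣-insert : ∀ {n} (s : Subset n) {i} → i ∉ s → ∣ s [ i ]≔ inside ∣ ≡ suc ∣ s ∣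
∣∣-insert (true  ∷ s) {zero}  i∉s = ⊥-elim (i∉s here)
∣∣-insert (false ∷ s) {zero}  i∉s = refl
∣∣-insert (true  ∷ s) {suc i} i∉s = cong suc (∣∣-insert s (i∉s ∘ there))
∣∣-insert (false ∷ s) {suc i} i∉s = ∣∣-insert s (i∉s ∘ there)

∣∣-delete : ∀ {n} (s : Subset n) {i} → i ∈ s → ∣ s ∣ ≡ suc ∣ s [ i ]≔ outside ∣
∣∣-delete (true  ∷ s) here        = refl
∣∣-delete (true  ∷ s) (there i∈s) = cong suc (∣∣-delete s i∈s)
∣∣-delete (false ∷ s) (there i∈s) = ∣∣-delete s i∈s

∈-insert⁻ : ∀ {n} (s : Subset n) {i j} → j ∈ s [ i ]≔ inside → i ≢ j → j ∈ s
∈-insert⁻ s {i} {j} j∈ i≢j =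
  lookup⇒[]= j s (trans (sym (lookup∘update′ (≢-sym i≢j) s inside)) ([]=⇒lookup j∈))

∈-delete⁻ : ∀ {n} (s : Subset n) {i j} → j ∈ s [ i ]≔ outside → i ≢ j × j ∈ s
∈-delete⁻ s {i} {j} j∈ = i≢j ,
  lookup⇒[]= j s (trans (sym (lookup∘update′ (≢-sym i≢j) s outside)) ([]=⇒lookup j∈))
  where
  i≢j : i ≢ j
  i≢j refl with trans (sym ([]=⇒lookup j∈)) (lookup∘update i s outside)
  ... | ()

∈-delete⁺ : ∀ {n} (s : Subset n) {i j} → i ≢ j → j ∈ s → j ∈ s [ i ]≔ outside
∈-delete⁺ s {i} {j} i≢j j∈s =
  lookup⇒[]= j _ (trans (lookup∘update′ (≢-sym i≢j) s outside) ([]=⇒lookup j∈s))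

-- Table positions and an abstract order of chains

module Positions (n : ℕ) where

  -- Index suc i stands for disk i and index zero for the bottom of a chain.
  Index : Set
  Index = Fin (suc n)

  Position : Set
  Position = Index × Index × Index

  _≟ₚ_ : DecidableEquality Position
  _≟ₚ_ = ≡-dec Fin._≟_ (≡-dec Fin._≟_ Fin._≟_)

  open Update _≟ₚ_ public

-- Along the line, ⊑ compares positions and ≺ says in addition that the disks
-- are disjoint, so the independent sets are the chains of ≺.
record ChainOrder {n : ℕ} (Adj : Fin n → Fin n → Set) : Set₁ where
  infix 4 _⊑_ _≺_
  field
    Adj-sym : ∀ {i j} → Adj i j → Adj j i
    _⊑_ _≺_ : Fin n → Fin n → Set
    ⊑-total : ∀ i j → i ⊑ j ⊎ j ⊑ i
    ⊑-trans : ∀ {i j k} → i ⊑ j → j ⊑ k → i ⊑ k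
    ≺⇒⊑     : ∀ {i j} → i ≺ j → i ⊑ j
    ≺⇒⋣     : ∀ {i j} → i ≺ j → ¬ j ⊑ i
    ≺-trans : ∀ {i j k} → i ≺ j → j ≺ k → i ≺ k
    ≺⇒¬Adj  : ∀ {i j} → i ≺ j → ¬ Adj i j
    ¬Adj⇒≺  : ∀ {i j} → i ≢ j → ¬ Adj i j → i ⊑ j → i ≺ j

-- Dynamic programming over the tops of two chains

module TwoChains {n : ℕ} {Adj : Fin n → Fin n → Set} (order : ChainOrder Adj) where
  open ChainOrder order
  open Positions n

  infix 4 _≺₀_ _⊏₀_

  -- `≺₀` is asked of the chain that grows and `⊏₀` of the other top. Since keys may tie, `⊏₀` has
  -- to state distinctness separately.
  _≺₀_ _⊏₀_ : Index → Fin n → Set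
  zero  ≺₀ m = ⊤
  suc k ≺₀ m = k ≺ m
  zero  ⊏₀ m = ⊤
  suc l ⊏₀ m = l ⊑ m × l ≢ m

  ≺₀-trans : ∀ k {i j} → k ≺₀ i → i ≺ j → k ≺₀ j
  ≺₀-trans zero    _   _   = tt
  ≺₀-trans (suc k) k≺i i≺j = ≺-trans k≺i i≺j

  ≺₀-⊏₀-trans : ∀ k {i j} → k ≺₀ i → suc i ⊏₀ j → k ⊏₀ j
  ≺₀-⊏₀-trans zero    _   _         = tt
  ≺₀-⊏₀-trans (suc k) k≺i (i⊑j , _) =
    ⊑-trans (≺⇒⊑ k≺i) i⊑j , λ { refl → ≺⇒⋣ k≺i i⊑j }

  ≺⇒≢ : ∀ {i j} → i ≺ j → i ≢ j
  ≺⇒≢ i≺i refl = ≺⇒⋣ i≺i (≺⇒⊑ i≺i)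

  -- When complete, T (r , k , l) is positive iff two disjoint chains with r
  -- disks in total have tops k and l, where l is not after k; for r > 0 it is
  -- then one more than the index of the disk below k.
  Table : Set
  Table = Position → ℕ

  Filled : Table → Position → Set
  Filled T p = 1 ≤ T p

  -- Only the orientation with the last added disk first is stored, so an unordered pair of tops is
  -- looked up in both.
  Reached : Table → Position → Set
  Reached T (r , k , l) = Filled T (r , k , l) ⊎ Filled T (r , l , k)

  -- An entry refers to its predecessor only as being filled, so overwriting a filled entry with
  -- another back pointer invalidates nothing.
  Justified : Table → Position → Set
  Justified T (zero  , k , l) = k ≡ zero × l ≡ zero
  Justified T (suc r , k , l) = ∃[ m ] ∃[ k′ ]
    (k ≡ suc m × T (suc r , k , l) ≡ suc (toℕ k′) × k′ ≺₀ m × l ⊏₀ m × Reached T (inject₁ r , k′ , l))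

  record Sound (T : Table) (best : Position) : Set where
    field
      root        : Filled T (zero , zero , zero)
      justified   : ∀ p → Filled T p → Justified T p
      best-filled : Filled T best
      best-max    : ∀ p → Filled T p → toℕ (proj₁ p) ≤ toℕ (proj₁ best)

  -- The time at which the four nested loops visit the quadruple.
  rank : Fin n → Index → Index → Fin n → ℕ
  rank r k l m = toℕ (combine r (combine k (combine l m)))

  Done : Table → Fin n → Index → Index → Fin n → Set
  Done T r k l m = Reached T (inject₁ r , k , l) → k ≺₀ m → l ⊏₀ m → Filled T (suc r , suc m , l)

  DoneBelow : Table → ℕ → Set
  DoneBelow T t = ∀ r k l m → rank r k l m < t → Done T r k l m

  rank-injective : ∀ r k l m r′ k′ l′ m′ → rank r k l m ≡ rank r′ k′ l′ m′ →
                   (r , k , l , m) ≡ (r′ , k′ , l′ , m′)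
  rank-injective r k l m r′ k′ l′ m′ eq
    with refl , eq₁ ← Fin.combine-injective r _ r′ _ (Fin.toℕ-injective eq)
    with refl , eq₂ ← Fin.combine-injective k (combine l m) k′ (combine l′ m′) eq₁
    with refl , refl ← Fin.combine-injective l m l′ m′ eq₂ = refl

  doneBelow-suc : ∀ {T} r k l m → DoneBelow T (rank r k l m) → Done T r k l m →
                  DoneBelow T (suc (rank r k l m))
  doneBelow-suc r k l m below done r′ k′ l′ m′ (s≤s rank≤) with ℕ.m≤n⇒m<n∨m≡n rank≤
  ... | inj₁ rank< = below r′ k′ l′ m′ rank<
  ... | inj₂ rank≡ with refl ← rank-injective r′ k′ l′ m′ r k l m rank≡ = done

  -- One write of the innermost loop. The newest entry always becomes the best one: `r` never
  -- decreases, so no filled entry has more disks.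
  module Write (T : Table) (best : Position) (r : Fin n) (k l : Index) (m : Fin n)
               (sound : Sound T best) (best≤ : toℕ (proj₁ best) ≤ suc (toℕ r))
               (reached : Reached T (inject₁ r , k , l)) (k≺m : k ≺₀ m) (l⊏m : l ⊏₀ m) where
    open Sound sound

    new : Position
    new = suc r , suc m , l

    T′ : Table
    T′ = T [ new ↦ suc (toℕ k) ]

    T′-new : T′ new ≡ suc (toℕ k)
    T′-new = update-same T new _

    filled : ∀ {p} → Filled T p → Filled T′ p
    filled {p} 1≤ with new ≟ₚ p
    ... | yes _ = s≤s z≤n
    ... | no  _ = 1≤

    reached′ : ∀ {p} → Reached T p → Reached T′ p
    reached′ = Sum.map filled filled

    T′-old : ∀ {r′} k l → toℕ r′ ≤ toℕ r → T′ (r′ , k , l) ≡ T (r′ , k , l)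
    T′-old k l r′≤r = update-other T new _ λ { refl → ℕ.1+n≰n r′≤r }

    reached-old : ∀ {r′} k l → toℕ r′ ≤ toℕ r → Reached T′ (r′ , k , l) → Reached T (r′ , k , l)
    reached-old k l r′≤r =
      Sum.map (subst (1 ≤_) (T′-old k l r′≤r)) (subst (1 ≤_) (T′-old l k r′≤r))

    justified-mono : ∀ p → T′ p ≡ T p → Justified T p → Justified T′ p
    justified-mono (zero  , _) _ j = j
    justified-mono (suc _ , _) same (i , k′ , k≡ , T≡ , k′≺i , l⊏i , reach) =
      i , k′ , k≡ , trans same T≡ , k′≺i , l⊏i , reached′ reach

    justified′ : ∀ p → Filled T′ p → Justified T′ p
    justified′ p 1≤ = by-cases (new ≟ₚ p)
      where
      by-cases : Dec (new ≡ p) → Justified T′ p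
      by-cases (yes refl) = m , k , refl , T′-new , k≺m , l⊏m , reached′ reached
      by-cases (no new≢p) = justified-mono p same (justified p (subst (1 ≤_) same 1≤))
        where
        same : T′ p ≡ T p
        same = update-other T new _ new≢p

    sound′ : Sound T′ new
    sound′ = record
      { root        = filled root
      ; justified   = justified′
      ; best-filled = subst (1 ≤_) (sym T′-new) (s≤s z≤n)
      ; best-max    = λ p 1≤ → max p 1≤ (new ≟ₚ p)
      }
      where
      max : ∀ p → Filled T′ p → Dec (new ≡ p) → toℕ (proj₁ p) ≤ suc (toℕ r)
      max p 1≤ (yes refl) = ℕ.≤-refl
      max p 1≤ (no new≢p) =
        ℕ.≤-trans (best-max p (subst (1 ≤_) (update-other T new _ new≢p) 1≤)) best≤

    -- A newly reached state could falsify `Done`. But quadruples of smaller rank have `r′ ≤ r` and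
    -- consult layers up to `r`, while the write is in layer `suc r`.
    doneBelow′ : DoneBelow T (rank r k l m) → DoneBelow T′ (suc (rank r k l m))
    doneBelow′ below = doneBelow-suc {T′} r k l m old (λ _ _ _ → subst (1 ≤_) (sym T′-new) (s≤s z≤n))
      where
      old : DoneBelow T′ (rank r k l m)
      old r′ k′ l′ m′ rank< reach k≺ l⊏ = filled (below r′ k′ l′ m′ rank<
        (reached-old k′ l′ (subst (_≤ toℕ r) (sym (Fin.toℕ-inject₁ r′)) r′≤r) reach) k≺ l⊏)
        where
        r′≤r : toℕ r′ ≤ toℕ r
        r′≤r = ℕ.≮⇒≥ λ r<r′ → ℕ.<-asym rank< (Fin.combine-monoˡ-< _ _ r<r′)

  -- Completeness: properly two-coloured sets are reached

  Proper : Subset n → (Fin n → Bool) → Set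
  Proper s colour = ∀ {i j} → i ∈ s → j ∈ s → i ≢ j → colour i ≡ colour j → ¬ Adj i j

  ⊑-refl : ∀ {i} → i ⊑ i
  ⊑-refl {i} = Sum.reduce (⊑-total i i)

  maximum : ∀ {m} (f : Fin m → Fin n) {P : Fin m → Set} → (∀ i → Dec (P i)) →
            (∀ i → ¬ P i) ⊎ ∃[ k ] (P k × (∀ i → P i → f i ⊑ f k))
  maximum {zero}  f P? = inj₁ λ ()
  maximum {suc m} f P? with P? zero | maximum (f ∘ suc) (P? ∘ suc)
  ... | no ¬P₀ | inj₁ none = inj₁ λ { zero → ¬P₀ ; (suc i) → none i }
  ... | no ¬P₀ | inj₂ (k , Pk , max) =
    inj₂ (suc k , Pk , λ { zero P₀ → ⊥-elim (¬P₀ P₀) ; (suc i) → max i })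
  ... | yes P₀ | inj₁ none =
    inj₂ (zero , P₀ , λ { zero _ → ⊑-refl ; (suc i) Pi → ⊥-elim (none i Pi) })
  ... | yes P₀ | inj₂ (k , Pk , max) with ⊑-total (f (suc k)) (f zero)
  ...   | inj₂ 0⊑k = inj₂ (suc k , Pk , λ { zero _ → 0⊑k ; (suc i) → max i })
  ...   | inj₁ k⊑0 =
    inj₂ (zero , P₀ , λ { zero _ → ⊑-refl ; (suc i) Pi → ⊑-trans (max i Pi) k⊑0 })

  module Complete {T : Table} (root : Filled T (zero , zero , zero)) (done : ∀ r k l m → Done T r k l m)
                  (colour : Fin n → Bool) where

    Top : Subset n → Bool → Index → Set
    Top s b zero    = ∀ {i} → i ∈ s → colour i ≢ b
    Top s b (suc k) = k ∈ s × colour k ≡ b × (∀ {i} → i ∈ s → colour i ≡ b → i ⊑ k)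

    top : ∀ s b → ∃[ k ] Top s b k
    top s b with maximum (λ i → i) (λ i → (i ∈? s) ×-dec (colour i Bool.≟ b))
    ... | inj₁ none                   = zero , λ i∈s c → none _ (i∈s , c)
    ... | inj₂ (k , (k∈s , c) , max) = suc k , k∈s , c , λ i∈s c → max _ (i∈s , c)

    top-delete : ∀ s b l {m} → colour m ≢ b → Top s b l → Top (s [ m ]≔ outside) b l
    top-delete s b zero    m≢b none            = λ i∈ → none (proj₂ (∈-delete⁻ s i∈))
    top-delete s b (suc l) m≢b (l∈s , c , max) =
      ∈-delete⁺ s (λ { refl → m≢b c }) l∈s , c , λ i∈ → max (proj₂ (∈-delete⁻ s i∈))

    -- The next disk of the same colour is neither adjacent to `m` nor after it, which is what
    -- `¬Adj⇒≺` asks for.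
    below-top : ∀ s b k {m} → Proper s colour → Top s b (suc m) → Top (s [ m ]≔ outside) b k → k ≺₀ m
    below-top s b zero    _      _               _              = tt
    below-top s b (suc k) proper (m∈s , c , max) (k∈ , c′ , _) with ∈-delete⁻ s k∈
    ... | m≢k , k∈s = ¬Adj⇒≺ (≢-sym m≢k) (proper k∈s m∈s (≢-sym m≢k) (trans c′ (sym c))) (max k∈s c′)

    -- Induction on the number of disks: the later of the two tops is taken as the last one added,
    -- and `extend` removes it. `size` is an argument of its own so that the recursion is
    -- structural.
    reach : ∀ size s (r : Index) → ∣ s ∣ ≡ size → toℕ r ≡ size → Proper s colour →
            ∀ b k l → Top s b k → Top s (not b) l → Reached T (r , k , l)

    extend : ∀ size s (r : Index) → ∣ s ∣ ≡ size → toℕ r ≡ size → Proper s colour →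
             ∀ b m l → Top s b (suc m) → Top s (not b) l → l ⊏₀ m → Filled T (r , suc m , l)
    extend zero    s r       ∣s∣≡ r≡ proper b m l top-m top-l l⊏m
      with () ← trans (sym ∣s∣≡) (∣∣-delete s (proj₁ top-m))
    extend (suc c) s (suc r) ∣s∣≡ r≡ proper b m l top-m top-l l⊏m =
      let k , top-k = top (s [ m ]≔ outside) b in
      done r k l m
        (reach c (s [ m ]≔ outside) (inject₁ r)
          (ℕ.suc-injective (trans (sym (∣∣-delete s (proj₁ top-m))) ∣s∣≡))
          (trans (Fin.toℕ-inject₁ r) (ℕ.suc-injective r≡))
          (λ i∈ j∈ → proper (proj₂ (∈-delete⁻ s i∈)) (proj₂ (∈-delete⁻ s j∈)))
          b k l top-k
          (top-delete s (not b) l (Bool.not-¬ (proj₁ (proj₂ top-m))) top-l))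
        (below-top s b k proper top-m top-k) l⊏m

    reach size s r ∣s∣≡ r≡ proper b zero zero none none′ =
      subst (λ r → Reached T (r , zero , zero))
        (Fin.toℕ-injective (trans (sym empty) (trans ∣s∣≡ (sym r≡)))) (inj₁ root)
      where
      empty : ∣ s ∣ ≡ 0
      empty = trans
        (cong ∣_∣ (Empty-unique λ { (i , i∈s) → none′ i∈s (Bool.¬-not (none i∈s)) })) (∣⊥∣≡0 n)
    reach size s r ∣s∣≡ r≡ proper b (suc i) zero top-k top-l =
      inj₁ (extend size s r ∣s∣≡ r≡ proper b i zero top-k top-l tt)
    -- The colours exchange roles here, so the first class is now that of `not (not b)`.
    reach size s r ∣s∣≡ r≡ proper b zero (suc j) top-k top-l =
      inj₂ (extend size s r ∣s∣≡ r≡ proper (not b) j zero top-l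
        (subst (λ b → Top s b zero) (sym (Bool.not-involutive b)) top-k) tt)
    reach size s r ∣s∣≡ r≡ proper b (suc i) (suc j) top-k top-l with ⊑-total i j
    ... | inj₁ i⊑j = inj₂ (extend size s r ∣s∣≡ r≡ proper (not b) j (suc i) top-l
        (subst (λ b → Top s b (suc i)) (sym (Bool.not-involutive b)) top-k) (i⊑j , i≢j))
      where
      i≢j : i ≢ j
      i≢j refl = Bool.not-¬ refl (trans (sym (proj₁ (proj₂ top-k))) (proj₁ (proj₂ top-l)))
    ... | inj₂ j⊑i = inj₁ (extend size s r ∣s∣≡ r≡ proper b i (suc j) top-k top-l (j⊑i , j≢i))
      where
      j≢i : j ≢ i
      j≢i refl = Bool.not-¬ refl (trans (sym (proj₁ (proj₂ top-k))) (proj₁ (proj₂ top-l)))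

  size-bound : ∀ {T best} → Sound T best → (∀ r k l m → Done T r k l m) →
               ∀ s colour → Proper s colour → ∣ s ∣ ≤ toℕ (proj₁ best)
  size-bound {T} {best} sound done s colour proper =
    let k , top-k = top s true
        l , top-l = top s false
    in subst (_≤ toℕ (proj₁ best)) r≡
         (Sum.reduce (Sum.map (best-max _) (best-max _)
           (reach ∣ s ∣ s (fromℕ< ∣s∣<) refl r≡ proper true k l top-k top-l)))
    where
    open Sound sound
    open Complete {T} root done colour

    ∣s∣< : ∣ s ∣ < suc n
    ∣s∣< = s≤s (∣p∣≤n s)

    r≡ : toℕ (fromℕ< ∣s∣<) ≡ ∣ s ∣
    r≡ = Fin.toℕ-fromℕ< ∣s∣<

  -- Soundness: tracing the table backwards

  -- s holds the disks already taken, all of which lie above the tops k and l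
  -- of what remains of the two chains.
  record Partial (T : Table) (p : Position) (s : Subset n) : Set where
    field
      colour  : Fin n → Bool
      proper  : Proper s colour
      reached : Reached T p
      above   : ∀ {i} → i ∈ s → if colour i then (proj₁ (proj₂ p) ≺₀ i × proj₂ (proj₂ p) ⊏₀ i)
                                            else (proj₂ (proj₂ p) ≺₀ i × proj₁ (proj₂ p) ⊏₀ i)

  partial-swap : ∀ {T r k l s} → Partial T (r , k , l) s → Partial T (r , l , k) s
  partial-swap {T} {r} {k} {l} {s} part = record
    { colour  = not ∘ colour
    ; proper  = λ i∈ j∈ i≢j c → proper i∈ j∈ i≢j (Bool.not-injective c)
    ; reached = Sum.swap reached
    ; above   = λ {i} i∈ → flip (colour i) (above i∈)
    }
    where
    open Partial part
    flip : ∀ b {i} → (if b then (k ≺₀ i × l ⊏₀ i) else (l ≺₀ i × k ⊏₀ i)) →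
           (if not b then (l ≺₀ i × k ⊏₀ i) else (k ≺₀ i × l ⊏₀ i))
    flip true  a = a
    flip false a = a

  -- The popped disk gets colour `true`, that of the first chain. It is new because `above` would
  -- place it strictly below itself in its own chain and make it distinct from itself in the other.
  partial-pop : ∀ {T best r k l s} → Sound T best → Filled T (suc r , k , l) →
                Partial T (suc r , k , l) s →
                ∃[ m ] ∃[ k′ ] (k ≡ suc m × T (suc r , k , l) ≡ suc (toℕ k′) × m ∉ s ×
                                Partial T (inject₁ r , k′ , l) (s [ m ]≔ inside))
  partial-pop {T} {_} {r} {k} {l} {s} sound filled part with Sound.justified sound _ filled
  ... | m , k′ , refl , T≡ , k′≺m , l⊏m , reach = m , k′ , refl , T≡ , m∉s , record
    { colour  = colour′
    ; proper  = proper′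
    ; reached = reach
    ; above   = above′
    }
    where
    open Partial part

    m∉s : m ∉ s
    m∉s m∈s with colour m | above m∈s
    ... | true  | m≺m , _         = ≺⇒≢ m≺m refl
    ... | false | _ , (_ , m≢m)   = m≢m refl

    colour′ : Fin n → Bool
    colour′ i = if does (m Fin.≟ i) then true else colour i

    proper′ : Proper (s [ m ]≔ inside) colour′
    proper′ {i} {j} i∈ j∈ i≢j c with m Fin.≟ i | m Fin.≟ j
    ... | yes refl | yes refl = ⊥-elim (i≢j refl)
    ... | yes refl | no m≢j   =
      ≺⇒¬Adj (proj₁ (subst (λ b → if b then _ else _) (sym c) (above (∈-insert⁻ s j∈ m≢j))))
    ... | no m≢i   | yes refl =
      ≺⇒¬Adj (proj₁ (subst (λ b → if b then _ else _) c (above (∈-insert⁻ s i∈ m≢i)))) ∘ Adj-sym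
    ... | no m≢i   | no m≢j   = proper (∈-insert⁻ s i∈ m≢i) (∈-insert⁻ s j∈ m≢j) i≢j c

    above′ : ∀ {i} → i ∈ s [ m ]≔ inside →
             if colour′ i then (k′ ≺₀ i × l ⊏₀ i) else (l ≺₀ i × k′ ⊏₀ i)
    above′ {i} i∈ with m Fin.≟ i
    ... | yes refl = k′≺m , l⊏m
    ... | no m≢i with colour i | above (∈-insert⁻ s i∈ m≢i)
    ...   | true  | m≺i , l⊏i = ≺₀-trans k′ k′≺m m≺i , l⊏i
    ...   | false | l≺i , m⊏i = l≺i , ≺₀-⊏₀-trans k′ k′≺m m⊏i

-- Memory size and program building blocks

tableSize : ℕ → ℕ
tableSize n = suc n * (suc n * suc n)

space : ℕ → ℕ
space n = suc n + (7 + tableSize n)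

whileCost : ℕ → ℕ → ℕ → ℕ
whileCost test body zero    = suc test
whileCost test body (suc k) = suc (test + (body + whileCost test body k))

assignCost : WordExp → WordExp → ℕ
assignCost e f = suc (costʷ e + costʷ f)

nʷ Nʷ : WordExp
nʷ = word[ lit 0 ]
Nʷ = nʷ +ʷ lit 1

varʷ : Fin 7 → WordExp
varʷ v = nʷ +ʷ lit (suc (toℕ v))

get : Fin 7 → WordExp
get v = word[ varʷ v ]

-- The table starts after `n + 1` low words and seven variables; the offset in it is the row-major
-- one computed by `combine`.
tblʷ : WordExp → WordExp → WordExp → WordExp
tblʷ e f g = (nʷ +ʷ lit 8) +ʷ (Nʷ *ʷ Nʷ *ʷ e +ʷ (Nʷ *ʷ f +ʷ g))

for : Fin 7 → WordExp → Program → Program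
for v b p = (word[ varʷ v ]≔ lit 0) ⨾
            while (get v +ʷ lit 1 ≤ʷ b) (p ⨾ (word[ varʷ v ]≔ get v +ʷ lit 1))

forCost : Fin 7 → WordExp → ℕ → ℕ → ℕ
forCost v b c k = assignCost (varʷ v) (lit 0) +
  whileCost (costᵗ (get v +ʷ lit 1 ≤ʷ b)) (c + assignCost (varʷ v) (get v +ʷ lit 1)) k

whileCost-mono : ∀ t c {k k′} → k ≤ k′ → whileCost t c k ≤ whileCost t c k′
whileCost-mono t c {k′ = zero}  z≤n = ℕ.≤-refl
whileCost-mono t c {k′ = suc _} z≤n = s≤s (ℕ.m≤m+n t _)
whileCost-mono t c (s≤s k≤k′)       = s≤s (ℕ.+-monoʳ-≤ t (ℕ.+-monoʳ-≤ c (whileCost-mono t c k≤k′)))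

-- Memory cells and their addresses

-- Memory: n and then the marks of the disks in words 0 to n, seven variables,
-- and the table.
module Cells (n : ℕ) where
  open Positions n using (Index; Position; _≟ₚ_)

  data Cell : Set where
    low : Index → Cell
    var : Fin 7 → Cell
    tbl : Position → Cell

  address : Cell → Fin (space n)
  address (low j)             = j ↑ˡ _
  address (var v)             = suc n ↑ʳ (v ↑ˡ _)
  address (tbl (r , k , l))   = suc n ↑ʳ (7 ↑ʳ combine r (combine k l))

  ↑ˡ≢↑ʳ : ∀ {m k} (i : Fin m) (j : Fin k) → i ↑ˡ k ≢ m ↑ʳ j
  ↑ˡ≢↑ʳ {m} {k} i j eq
    with () ← trans (sym (Fin.splitAt-↑ˡ m i k)) (trans (cong (splitAt m) eq) (Fin.splitAt-↑ʳ m k j))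

  -- Rules out aliasing, so that memory can be treated as a function on `Cell`.
  address-injective : ∀ c d → address c ≡ address d → c ≡ d
  address-injective (low i) (low j) eq = cong low (Fin.↑ˡ-injective _ i j eq)
  address-injective (low i) (var v) eq = ⊥-elim (↑ˡ≢↑ʳ i _ eq)
  address-injective (low i) (tbl p) eq = ⊥-elim (↑ˡ≢↑ʳ i _ eq)
  address-injective (var v) (low j) eq = ⊥-elim (↑ˡ≢↑ʳ j _ (sym eq))
  address-injective (var v) (var w) eq =
    cong var (Fin.↑ˡ-injective _ v w (Fin.↑ʳ-injective (suc n) _ _ eq))
  address-injective (var v) (tbl p) eq = ⊥-elim (↑ˡ≢↑ʳ v _ (Fin.↑ʳ-injective (suc n) _ _ eq))
  address-injective (tbl p) (low j) eq = ⊥-elim (↑ˡ≢↑ʳ j _ (sym eq))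
  address-injective (tbl p) (var w) eq = ⊥-elim (↑ˡ≢↑ʳ w _ (sym (Fin.↑ʳ-injective (suc n) _ _ eq)))
  address-injective (tbl (r , k , l)) (tbl (r′ , k′ , l′)) eq
    with refl , eq₁ ← Fin.combine-injective r (combine k l) r′ (combine k′ l′)
                        (Fin.↑ʳ-injective 7 _ _ (Fin.↑ʳ-injective (suc n) _ _ eq))
    with refl , refl ← Fin.combine-injective k l k′ l′ eq₁ = refl

  _≟ᶜ_ : DecidableEquality Cell
  low i ≟ᶜ low j = map′ (cong low) (λ { refl → refl }) (i Fin.≟ j)
  low _ ≟ᶜ var _ = no λ ()
  low _ ≟ᶜ tbl _ = no λ ()
  var _ ≟ᶜ low _ = no λ ()
  var v ≟ᶜ var w = map′ (cong var) (λ { refl → refl }) (v Fin.≟ w)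
  var _ ≟ᶜ tbl _ = no λ ()
  tbl _ ≟ᶜ low _ = no λ ()
  tbl _ ≟ᶜ var _ = no λ ()
  tbl p ≟ᶜ tbl q = map′ (cong tbl) (λ { refl → refl }) (p ≟ₚ q)

  open Update _≟ᶜ_ public

  Contents : Set
  Contents = Cell → ℕ

  table : Contents → Position → ℕ
  table A p = A (tbl p)

-- A program logic with cost bounds

module Logic (ℝ : RealNumbers) (n : ℕ) (ρ : Vec (RealNumbers.Carrier ℝ) (space n)) where
  open RealNumbers ℝ using (Carrier; 1#; -_; _≤?_) renaming (_+_ to _+ᵣ_; _*_ to _*ᵣ_)
  open Cells n public
  open RealRAM ℝ (space n)

  infix 4 _≃_ _⊢_⇓_ _⊢_⇓ʳ_ _⊢_⇓ᵗ_

  -- The program never writes a real, so the real memory stays the fixed input `ρ`.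
  record _≃_ (σ : Memory) (A : Contents) : Set where
    field
      contents : ∀ c → toℕ (lookup (words σ) (address c)) ≡ A c
      input    : reals σ ≡ ρ

  open _≃_

  record _⊢_⇓_ (A : Contents) (e : WordExp) (v : ℕ) : Set where
    constructor ⇓ʷ
    field
      eval : ∀ {σ} → σ ≃ A → ∃[ w ] (evalʷ σ e ≡ just w × toℕ w ≡ v)

  record _⊢_⇓ʳ_ (A : Contents) (e : RealExp) (r : Carrier) : Set where
    constructor ⇓ʳ
    field
      evalR : ∀ {σ} → σ ≃ A → evalʳ σ e ≡ just r

  -- A test is tied to a decision, so that the branch taken comes with a proof or a refutation.
  record _⊢_⇓ᵗ_ (A : Contents) (t : Test) {P : Set} (P? : Dec P) : Set where
    constructor ⇓ᵗ
    field
      evalT : ∀ {σ} → σ ≃ A → evalᵗ σ t ≡ just (does P?)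

  open _⊢_⇓_
  open _⊢_⇓ʳ_
  open _⊢_⇓ᵗ_

  toWord-just : ∀ {v} → v < space n → ∃[ w ] (toWord v ≡ just w × toℕ w ≡ v)
  toWord-just {v} v<S rewrite dec-yes-irr (v ℕ.<? space n) ℕ.<-irrelevant v<S =
    fromℕ< v<S , refl , Fin.toℕ-fromℕ< v<S

  lit⇓ : ∀ {A v} → v < space n → A ⊢ lit v ⇓ v
  lit⇓ v<S .eval _ = toWord-just v<S

  cell⇓ : ∀ {A e} c → A ⊢ e ⇓ toℕ (address c) → A ⊢ word[ e ] ⇓ A c
  cell⇓ c e⇓ .eval {σ} σ≃A with eval e⇓ σ≃A
  ... | w , eq , w≡ rewrite eq | Fin.toℕ-injective w≡ = _ , refl , contents σ≃A c

  +⇓ : ∀ {A e f v w} → A ⊢ e ⇓ v → A ⊢ f ⇓ w → v + w < space n → A ⊢ e +ʷ f ⇓ v + w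
  +⇓ e⇓ f⇓ v+w<S .eval σ≃A with eval e⇓ σ≃A | eval f⇓ σ≃A
  ... | v′ , eq , refl | w′ , eq′ , refl rewrite eq | eq′ = toWord-just v+w<S

  *⇓ : ∀ {A e f v w} → A ⊢ e ⇓ v → A ⊢ f ⇓ w → v * w < space n → A ⊢ e *ʷ f ⇓ v * w
  *⇓ e⇓ f⇓ v*w<S .eval σ≃A with eval e⇓ σ≃A | eval f⇓ σ≃A
  ... | v′ , eq , refl | w′ , eq′ , refl rewrite eq | eq′ = toWord-just v*w<S

  ∸⇓ : ∀ {A e f v w} → A ⊢ e ⇓ v → A ⊢ f ⇓ w → A ⊢ e ∸ʷ f ⇓ v ∸ w
  ∸⇓ e⇓ f⇓ .eval σ≃A with eval e⇓ σ≃A | eval f⇓ σ≃A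
  ... | v′ , eq , refl | w′ , eq′ , refl rewrite eq | eq′ =
    toWord-just (ℕ.≤-<-trans (ℕ.m∸n≤m (toℕ v′) (toℕ w′)) (Fin.toℕ<n v′))

  ⇓-cong : ∀ {A e v w} → v ≡ w → A ⊢ e ⇓ v → A ⊢ e ⇓ w
  ⇓-cong refl e⇓ = e⇓

  1ʳ⇓ : ∀ {A} → A ⊢ 1ʳ ⇓ʳ 1#
  1ʳ⇓ .evalR _ = refl

  real⇓ʳ : ∀ {A e} i → A ⊢ e ⇓ toℕ i → A ⊢ real[ e ] ⇓ʳ lookup ρ i
  real⇓ʳ i e⇓ .evalR σ≃A with eval e⇓ σ≃A
  ... | w , eq , w≡ rewrite eq | Fin.toℕ-injective w≡ | input σ≃A = refl

  +ʳ⇓ : ∀ {A e f r s} → A ⊢ e ⇓ʳ r → A ⊢ f ⇓ʳ s → A ⊢ e +ʳ f ⇓ʳ r +ᵣ s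
  +ʳ⇓ e⇓ f⇓ .evalR σ≃A rewrite evalR e⇓ σ≃A | evalR f⇓ σ≃A = refl

  -ʳ⇓ : ∀ {A e f r s} → A ⊢ e ⇓ʳ r → A ⊢ f ⇓ʳ s → A ⊢ e -ʳ f ⇓ʳ r +ᵣ - s
  -ʳ⇓ e⇓ f⇓ .evalR σ≃A rewrite evalR e⇓ σ≃A | evalR f⇓ σ≃A = refl

  *ʳ⇓ : ∀ {A e f r s} → A ⊢ e ⇓ʳ r → A ⊢ f ⇓ʳ s → A ⊢ e *ʳ f ⇓ʳ r *ᵣ s
  *ʳ⇓ e⇓ f⇓ .evalR σ≃A rewrite evalR e⇓ σ≃A | evalR f⇓ σ≃A = refl

  ≤ʷ⇓ : ∀ {A e f v w} → A ⊢ e ⇓ v → A ⊢ f ⇓ w → A ⊢ e ≤ʷ f ⇓ᵗ (v ℕ.≤? w)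
  ≤ʷ⇓ e⇓ f⇓ .evalT σ≃A with eval e⇓ σ≃A | eval f⇓ σ≃A
  ... | v′ , eq , refl | w′ , eq′ , refl rewrite eq | eq′ = refl

  ≤ʳ⇓ : ∀ {A e f r s} → A ⊢ e ⇓ʳ r → A ⊢ f ⇓ʳ s → A ⊢ e ≤ʳ f ⇓ᵗ (r ≤? s)
  ≤ʳ⇓ e⇓ f⇓ .evalT σ≃A rewrite evalR e⇓ σ≃A | evalR f⇓ σ≃A = refl

  not⇓ : ∀ {A t P} {P? : Dec P} → A ⊢ t ⇓ᵗ P? → A ⊢ notᵗ t ⇓ᵗ ¬? P?
  not⇓ t⇓ .evalT σ≃A rewrite evalT t⇓ σ≃A = refl

  ∧⇓ : ∀ {A t u P Q} {P? : Dec P} {Q? : Dec Q} →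
       A ⊢ t ⇓ᵗ P? → A ⊢ u ⇓ᵗ Q? → A ⊢ t ∧ᵗ u ⇓ᵗ (P? ×-dec Q?)
  ∧⇓ t⇓ u⇓ .evalT σ≃A rewrite evalT t⇓ σ≃A | evalT u⇓ σ≃A = refl

  record Run (p : Program) (A : Contents) (cost : ℕ) (B : Contents) : Set where
    constructor running
    field
      run : ∀ {σ} → σ ≃ A → ∃[ σ′ ] ∃[ t ] ((⟨ p , σ ⟩⇓ σ′ taking t) × t ≤ cost × σ′ ≃ B)

  open Run

  Reaches : Program → Contents → ℕ → (Contents → Set) → Set
  Reaches p A cost Q = ∃[ B ] (Run p A cost B × Q B)

  skip-run : ∀ {A} → Run skip A 1 A
  skip-run .run σ≃A = _ , _ , skip⇓ , ℕ.≤-refl , σ≃A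

  assign-run : ∀ {A e f v} c → A ⊢ e ⇓ toℕ (address c) → A ⊢ f ⇓ v →
               Run (word[ e ]≔ f) A (assignCost e f) (A [ c ↦ v ])
  assign-run {A} {e} {f} {v} c e⇓ f⇓ .run {σ} σ≃A with eval e⇓ σ≃A | eval f⇓ σ≃A
  ... | a , eq , a≡ | w , eq′ , w≡ rewrite Fin.toℕ-injective a≡ =
    _ , _ , word⇓ eq eq′ , ℕ.≤-refl , record { contents = λ d → updated d (c ≟ᶜ d) ; input = input σ≃A }
    where
    updated : ∀ d → Dec (c ≡ d) → toℕ (lookup (words σ [ address c ]≔ w) (address d)) ≡ (A [ c ↦ v ]) d
    updated d (yes refl) = trans (cong toℕ (lookup∘update (address c) (words σ) w))
                                 (trans w≡ (sym (update-same A c v)))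
    updated d (no c≢d) =
      trans (cong toℕ (lookup∘update′ (λ eq → c≢d (sym (address-injective d c eq))) (words σ) w))
            (trans (contents σ≃A d) (sym (update-other A c v c≢d)))

  infixr 3 _then-run_
  _then-run_ : ∀ {p q A B C c d} → Run p A c B → Run q B d C → Run (p ⨾ q) A (c + d) C
  (r₁ then-run r₂) .run σ≃A with run r₁ σ≃A
  ... | σ′ , t , p⇓ , t≤ , σ′≃B with run r₂ σ′≃B
  ... | σ″ , u , q⇓ , u≤ , σ″≃C = σ″ , _ , seq⇓ p⇓ q⇓ , ℕ.+-mono-≤ t≤ u≤ , σ″≃C

  -- `d` stands for the cost of the branch not taken, so that both outcomes share one bound.
  if-true-run : ∀ {t p q A B c} {P : Set} {P? : Dec P} d → A ⊢ t ⇓ᵗ P? → P → Run p A c B →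
                Run (if t p q) A (suc (costᵗ t + (c + d))) B
  if-true-run {P? = no ¬P} d t⇓ P r = ⊥-elim (¬P P)
  if-true-run {c = c} {P? = yes _} d t⇓ P r .run σ≃A with run r σ≃A
  ... | σ′ , u , p⇓ , u≤ , σ′≃B =
    σ′ , _ , if-true⇓ (evalT t⇓ σ≃A) p⇓ , s≤s (ℕ.+-monoʳ-≤ _ (ℕ.≤-trans u≤ (ℕ.m≤m+n c d))) , σ′≃B

  if-false-run : ∀ {t p q A B c} {P : Set} {P? : Dec P} d → A ⊢ t ⇓ᵗ P? → ¬ P → Run q A c B →
                 Run (if t p q) A (suc (costᵗ t + (d + c))) B
  if-false-run {P? = yes P} d t⇓ ¬P r = ⊥-elim (¬P P)
  if-false-run {c = c} {P? = no _} d t⇓ ¬P r .run σ≃A with run r σ≃A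
  ... | σ′ , u , p⇓ , u≤ , σ′≃B =
    σ′ , _ , if-false⇓ (evalT t⇓ σ≃A) p⇓ , s≤s (ℕ.+-monoʳ-≤ _ (ℕ.≤-trans u≤ (ℕ.m≤n+m c d))) , σ′≃B

  weaken : ∀ {p A c d} {Q : Contents → Set} → c ≤ d → Reaches p A c Q → Reaches p A d Q
  weaken c≤d (B , running r , QB) = B , running (λ σ≃A →
    let σ′ , t , p⇓ , t≤ , σ′≃B = r σ≃A in σ′ , t , p⇓ , ℕ.≤-trans t≤ c≤d , σ′≃B) , QB

  infixl 2 _and-then_
  _and-then_ : ∀ {p q A c d} {Q R : Contents → Set} → Reaches p A c Q →
               (∀ {B} → Q B → Reaches q B d R) → Reaches (p ⨾ q) A (c + d) R
  (B , r , QB) and-then next with next QB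
  ... | C , r′ , RC = C , (r then-run r′) , RC

  record WhileTest (t : Test) (A : Contents) (k : ℕ) : Set₁ where
    constructor decides
    field
      {Holds} : Set
      {holds?} : Dec Holds
      test⇓   : A ⊢ t ⇓ᵗ holds?
      go      : 1 ≤ k → Holds
      stop    : k ≡ 0 → ¬ Holds

  -- Indexing the invariant by the exact number of iterations left gives termination and the cost
  -- bound in one induction.
  while-reaches : ∀ {t p c} (I : ℕ → Contents → Set) →
                  (∀ {k A} → I k A → WhileTest t A k) →
                  (∀ {k A} → I (suc k) A → Reaches p A c (I k)) →
                  ∀ k {A} → I k A → Reaches (while t p) A (whileCost (costᵗ t) c k) (I 0)
  while-reaches {t} {p} {c} I test body zero {A} IA = A , halt (test IA) , IA
    where
    halt : WhileTest t A 0 → Run (while t p) A (suc (costᵗ t)) A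
    halt (decides {holds? = yes h} t⇓ go stop) = ⊥-elim (stop refl h)
    halt (decides {holds? = no _} t⇓ go stop) .run σ≃A =
      _ , _ , while-false⇓ (evalT t⇓ σ≃A) , ℕ.≤-refl , σ≃A
  while-reaches {t} {p} {c} I test body (suc k) {A} IA with body IA
  ... | B , r , IB with while-reaches I test body k IB
  ... | C , r′ , IC = C , step (test IA) , IC
    where
    step : WhileTest t A (suc k) → Run (while t p) A (whileCost (costᵗ t) c (suc k)) C
    step (decides {holds? = no ¬h} t⇓ go stop) = ⊥-elim (¬h (go (s≤s z≤n)))
    step (decides {holds? = yes _} t⇓ go stop) .run σ≃A with run r σ≃A
    ... | σ′ , u , p⇓ , u≤ , σ′≃B with run r′ σ′≃B
    ... | σ″ , u′ , w⇓ , u′≤ , σ″≃C =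
      σ″ , _ , while-true⇓ (evalT t⇓ σ≃A) p⇓ w⇓ , s≤s (ℕ.+-monoʳ-≤ (costᵗ t) (ℕ.+-mono-≤ u≤ u′≤)) , σ″≃C

  base : Cell
  base = low zero

  -- 8, from the offset of the table, is the largest literal in the program.
  n+small : ∀ {v} → v ≤ 8 → n + v < space n
  n+small v≤8 = s≤s (ℕ.+-monoʳ-≤ n (ℕ.≤-trans v≤8 (ℕ.+-monoʳ-≤ 7 (s≤s z≤n))))

  small : ∀ {v} → v ≤ 8 → v < space n
  small {v} v≤8 = ℕ.≤-<-trans (ℕ.m≤n+m v n) (n+small v≤8)

  nʷ⇓ : ∀ {A} → A base ≡ n → A ⊢ nʷ ⇓ n
  nʷ⇓ A≡n = ⇓-cong A≡n (cell⇓ base (lit⇓ (s≤s z≤n)))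

  below-address : ∀ {v} c → v ≤ toℕ (address c) → v < space n
  below-address c v≤ = ℕ.≤-<-trans v≤ (Fin.toℕ<n (address c))

  var-address : ∀ v → n + suc (toℕ v) ≡ toℕ (address (var v))
  var-address v = trans (ℕ.+-suc n (toℕ v))
    (sym (trans (Fin.toℕ-↑ʳ (suc n) (v ↑ˡ tableSize n)) (cong (suc n +_) (Fin.toℕ-↑ˡ v (tableSize n)))))

  varʷ⇓ : ∀ {A} v → A base ≡ n → A ⊢ varʷ v ⇓ toℕ (address (var v))
  varʷ⇓ v A≡n = ⇓-cong (var-address v)
    (+⇓ (nʷ⇓ A≡n) (lit⇓ (small (ℕ.≤-trans (Fin.toℕ<n v) (ℕ.n≤1+n 7))))
      (below-address (var v) (ℕ.≤-reflexive (var-address v))))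

  get⇓ : ∀ {A x} v → A base ≡ n → A (var v) ≡ x → A ⊢ get v ⇓ x
  get⇓ v A≡n A≡x = ⇓-cong A≡x (cell⇓ (var v) (varʷ⇓ v A≡n))

  N : ℕ
  N = suc n

  Nʷ⇓ : ∀ {A} → A base ≡ n → A ⊢ Nʷ ⇓ N
  Nʷ⇓ A≡n = ⇓-cong (ℕ.+-comm n 1) (+⇓ (nʷ⇓ A≡n) (lit⇓ (small (s≤s z≤n))) (n+small (s≤s z≤n)))

  tbl-address : ∀ r k l →
    (n + 8) + (N * N * toℕ r + (N * toℕ k + toℕ l)) ≡ toℕ (address (tbl (r , k , l)))
  tbl-address r k l = sym (trans (Fin.toℕ-↑ʳ N _) (trans (cong (N +_) (trans (Fin.toℕ-↑ʳ 7 _)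
    (cong (7 +_) (trans (Fin.toℕ-combine r _) (cong (N * N * toℕ r +_) (Fin.toℕ-combine k l))))))
    (trans (sym (ℕ.+-assoc N 7 _))
      (cong (_+ (N * N * toℕ r + (N * toℕ k + toℕ l))) (sym (ℕ.+-suc n 7))))))

  tblʷ⇓ : ∀ {A e f g} r k l → A base ≡ n → A ⊢ e ⇓ toℕ r → A ⊢ f ⇓ toℕ k → A ⊢ g ⇓ toℕ l →
          A ⊢ tblʷ e f g ⇓ toℕ (address (tbl (r , k , l)))
  tblʷ⇓ {A} r k l A≡n e⇓ f⇓ g⇓ = ⇓-cong (tbl-address r k l)
    (+⇓ (+⇓ (nʷ⇓ A≡n) (lit⇓ (small ℕ.≤-refl)) (n+small ℕ.≤-refl))
        (+⇓ (*⇓ (*⇓ (Nʷ⇓ A≡n) (Nʷ⇓ A≡n) NN<) e⇓ (offset-fits (ℕ.m≤m+n _ _)))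
            (+⇓ (*⇓ (Nʷ⇓ A≡n) f⇓ (offset-fits (ℕ.≤-trans (ℕ.m≤m+n _ _) (ℕ.m≤n+m _ (N * N * toℕ r)))))
                g⇓ (offset-fits (ℕ.m≤n+m _ (N * N * toℕ r))))
            (offset-fits ℕ.≤-refl))
        (fits ℕ.≤-refl))
    where
    fits : ∀ {v} → v ≤ (n + 8) + (N * N * toℕ r + (N * toℕ k + toℕ l)) → v < space n
    fits v≤ = below-address (tbl (r , k , l)) (ℕ.≤-trans v≤ (ℕ.≤-reflexive (tbl-address r k l)))

    offset-fits : ∀ {v} → v ≤ N * N * toℕ r + (N * toℕ k + toℕ l) → v < space n
    offset-fits v≤ = fits (ℕ.≤-trans v≤ (ℕ.m≤n+m _ (n + 8)))

    -- In layer 0 this factor exceeds the product it enters, so the bound on the offset does not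
    -- cover it.
    NN< : N * N < space n
    NN< = ℕ.≤-trans (s≤s (ℕ.m≤n*m (N * N) N))
      (ℕ.≤-trans (ℕ.m≤n+m _ 6) (ℕ.≤-trans (ℕ.≤-reflexive (ℕ.+-suc 6 _)) (ℕ.m≤n+m _ N)))

  -- `J i` describes the state after `i` iterations and must ignore the counter, which the body has
  -- to preserve. The bound on `k + 1` is for the final test, which still evaluates this number.
  for-reaches : ∀ {b p c k} v (J : ℕ → Contents → Set) →
                (∀ {i A} → J i A → A base ≡ n) →
                (∀ {i A} → J i A → A ⊢ b ⇓ k) →
                (∀ {i A x} → J i A → J i (A [ var v ↦ x ])) →
                k + 1 < space n →
                (∀ (i : Fin k) {A} → A (var v) ≡ toℕ i → J (toℕ i) A →
                  Reaches p A c (λ B → B (var v) ≡ toℕ i × J (suc (toℕ i)) B)) →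
                ∀ {A} → J 0 A → Reaches (for v b p) A (forCost v b c k) (J k)
  for-reaches {b} {p} {c} {k} v J J-base J-bound J-var k+1<S body {A} J₀ =
    (A [ var v ↦ 0 ] , assign-run (var v) (varʷ⇓ v (J-base J₀)) (lit⇓ (small z≤n)) , start)
    and-then λ I → finish (while-reaches I′ test step k I)
    where
    I′ : ℕ → Contents → Set
    I′ r A = ∃[ i ] (i + r ≡ k × A (var v) ≡ i × J i A)

    start : I′ k (A [ var v ↦ 0 ])
    start = 0 , refl , update-same A (var v) 0 , J-var J₀

    finish : ∀ {q A c} → Reaches q A c (I′ 0) → Reaches q A c (J k)
    finish (B , r , i , eq , _ , Ji) = B , r , subst (λ i → J i B) (trans (sym (ℕ.+-identityʳ i)) eq) Ji

    suc< : ∀ {i r} → i + r ≡ k → i + 1 < space n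
    suc< {i} {r} eq = ℕ.≤-<-trans (ℕ.+-monoˡ-≤ 1 (subst (i ≤_) eq (ℕ.m≤m+n i r))) k+1<S

    test : ∀ {r A} → I′ r A → WhileTest (get v +ʷ lit 1 ≤ʷ b) A r
    test {r} (i , eq , A≡i , Ji) = decides
      (≤ʷ⇓ (+⇓ (get⇓ v (J-base Ji) A≡i) (lit⇓ (small (s≤s z≤n))) (suc< {i} {r} eq)) (J-bound Ji))
      (λ 1≤r → subst (i + 1 ≤_) eq (ℕ.+-monoʳ-≤ i 1≤r))
      (λ { refl i+1≤k → ℕ.1+n≰n (subst (_≤ i + 0) (ℕ.+-suc i 0) (subst (i + 1 ≤_) (sym eq) i+1≤k)) })

    step : ∀ {r A} → I′ (suc r) A → Reaches (p ⨾ (word[ varʷ v ]≔ get v +ʷ lit 1)) A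
             (c + assignCost (varʷ v) (get v +ʷ lit 1)) (I′ r)
    step {r} {A} (i , eq , A≡i , Ji) =
      body i′ (trans A≡i (sym i′≡)) (subst (λ i → J i A) (sym i′≡) Ji)
      and-then λ {B} (B≡i , JB) →
        _ , assign-run (var v) (varʷ⇓ v (J-base JB))
              (+⇓ (get⇓ v (J-base JB) B≡i) (lit⇓ (small (s≤s z≤n)))
                  (subst (λ i → i + 1 < space n) (sym i′≡) (suc< {i} eq)))
          , suc (toℕ i′)
          , trans (cong (λ i → suc i + r) i′≡) (trans (sym (ℕ.+-suc i r)) eq)
          , trans (update-same B (var v) _) (ℕ.+-comm (toℕ i′) 1)
          , J-var JB
      where
      i<k : i < k
      i<k = subst (suc i ≤_) eq (subst (suc i ≤_) (sym (ℕ.+-suc i r)) (s≤s (ℕ.m≤m+n i r)))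
      i′ : Fin k
      i′ = fromℕ< i<k
      i′≡ : toℕ i′ ≡ i
      i′≡ = Fin.toℕ-fromℕ< i<k

-- The program

-- Loop counters r, k, l, m, and the position R, K, L of the best entry so far,
-- from which the trace starts.
pattern rᵛ = 0F
pattern kᵛ = 1F
pattern lᵛ = 2F
pattern mᵛ = 3F
pattern Rᵛ = 4F
pattern Kᵛ = 5F
pattern Lᵛ = 6F

-- Arguments are indices, one more than the number of the disk, hence the offset 2 after three line
-- coefficients.
xʳ yʳ keyʳ : WordExp → RealExp
xʳ e   = real[ lit 2 +ʷ e ]
yʳ e   = real[ (lit 2 +ʷ nʷ) +ʷ e ]
keyʳ e = real[ lit 1 ] *ʳ xʳ e -ʳ real[ lit 0 ] *ʳ yʳ e

dist²ʳ : WordExp → WordExp → RealExp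
dist²ʳ e f = (xʳ e -ʳ xʳ f) *ʳ (xʳ e -ʳ xʳ f) +ʳ (yʳ e -ʳ yʳ f) *ʳ (yʳ e -ʳ yʳ f)

-- Index 0, the bottom of a chain, precedes every disk.
precedesᵗ beforeᵗ : WordExp → WordExp → Test
precedesᵗ e f = notᵗ (lit 1 ≤ʷ e ∧ᵗ notᵗ (keyʳ e ≤ʳ keyʳ f ∧ᵗ
                  notᵗ (dist²ʳ e f ≤ʳ (1ʳ +ʳ 1ʳ) *ʳ (1ʳ +ʳ 1ʳ))))
beforeᵗ   e f = notᵗ (lit 1 ≤ʷ e ∧ᵗ notᵗ (keyʳ e ≤ʳ keyʳ f ∧ᵗ notᵗ (e ≤ʷ f ∧ᵗ f ≤ʷ e)))

-- A disjunction in De Morgan form, as tests have only negation and conjunction.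
reachedᵗ : Test
reachedᵗ = notᵗ (notᵗ (lit 1 ≤ʷ word[ tblʷ (get rᵛ) (get kᵛ) (get lᵛ) ]) ∧ᵗ
                 notᵗ (lit 1 ≤ʷ word[ tblʷ (get rᵛ) (get lᵛ) (get kᵛ) ]))

extendᵗ : Test
extendᵗ = reachedᵗ ∧ᵗ precedesᵗ (get kᵛ) (get mᵛ +ʷ lit 1) ∧ᵗ beforeᵗ (get lᵛ) (get mᵛ +ʷ lit 1)

record-extension extend fill : Program
record-extension =
  (word[ tblʷ (get rᵛ +ʷ lit 1) (get mᵛ +ʷ lit 1) (get lᵛ) ]≔ get kᵛ +ʷ lit 1) ⨾
  (word[ varʷ Rᵛ ]≔ get rᵛ +ʷ lit 1) ⨾
  (word[ varʷ Kᵛ ]≔ get mᵛ +ʷ lit 1) ⨾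
  (word[ varʷ Lᵛ ]≔ get lᵛ)
extend = if extendᵗ record-extension skip
fill = for rᵛ nʷ (for kᵛ Nʷ (for lᵛ Nʷ (for mᵛ nʷ extend)))

-- Word 0 holds n until the very end, so disk 0 is marked in word n, and disk
-- i > 0 in word i.
markʷ : WordExp → WordExp
markʷ e = (e ∸ʷ lit 1) +ʷ nʷ *ʷ (lit 1 ∸ʷ (e ∸ʷ lit 1))

pop : Fin 7 → Fin 7 → Program
pop v w = (word[ markʷ (get v) ]≔ lit 1) ⨾
          (word[ varʷ v ]≔ word[ tblʷ (get Rᵛ) (get v) (get w) ] ∸ʷ lit 1)

pop-branch trace program : Program
pop-branch = if (lit 1 ≤ʷ word[ tblʷ (get Rᵛ) (get Kᵛ) (get Lᵛ) ]) (pop Kᵛ Lᵛ) (pop Lᵛ Kᵛ)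
trace = while (lit 1 ≤ʷ get Rᵛ) (pop-branch ⨾ (word[ varʷ Rᵛ ]≔ get Rᵛ ∸ʷ lit 1))
-- The last assignment gives up `n` in word 0 and fetches the mark of disk 0 from word `n`.
program = (word[ tblʷ (lit 0) (lit 0) (lit 0) ]≔ lit 1) ⨾ fill ⨾ trace ⨾ (word[ lit 0 ]≔ word[ nʷ ])

-- Polynomial bounds on time and space

popCost : Fin 7 → Fin 7 → ℕ
popCost v w = assignCost (markʷ (get v)) (lit 1) +
              assignCost (varʷ v) (word[ tblʷ (get Rᵛ) (get v) (get w) ] ∸ʷ lit 1)

initCost recordCost extendCost traceStepCost finishCost : ℕ
initCost = assignCost (tblʷ (lit 0) (lit 0) (lit 0)) (lit 1)
recordCost =
  assignCost (tblʷ (get rᵛ +ʷ lit 1) (get mᵛ +ʷ lit 1) (get lᵛ)) (get kᵛ +ʷ lit 1) +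
  (assignCost (varʷ Rᵛ) (get rᵛ +ʷ lit 1) +
  (assignCost (varʷ Kᵛ) (get mᵛ +ʷ lit 1) +
   assignCost (varʷ Lᵛ) (get lᵛ)))
extendCost = suc (costᵗ extendᵗ + (recordCost + 1))
traceStepCost =
  suc (costᵗ (lit 1 ≤ʷ word[ tblʷ (get Rᵛ) (get Kᵛ) (get Lᵛ) ]) + (popCost Kᵛ Lᵛ + popCost Lᵛ Kᵛ)) +
  assignCost (varʷ Rᵛ) (get Rᵛ ∸ʷ lit 1)
finishCost = assignCost (lit 0) word[ nʷ ]

mCost lCost kCost fillCost traceCost time : ℕ → ℕ
mCost n    = forCost mᵛ nʷ extendCost n
lCost n    = forCost lᵛ Nʷ (mCost n) (suc n)
kCost n    = forCost kᵛ Nʷ (lCost n) (suc n)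
fillCost n = forCost rᵛ nʷ (kCost n) n
traceCost  = whileCost (costᵗ (lit 1 ≤ʷ get Rᵛ)) traceStepCost
time n     = initCost + (fillCost n + (traceCost n + finishCost))

whileCost-bound : ∀ t c k → whileCost t c k ≤ suc k * suc (t + c)
whileCost-bound t c zero    = s≤s (ℕ.≤-trans (ℕ.m≤m+n t c) (ℕ.m≤m+n (t + c) 0))
whileCost-bound t c (suc k) = s≤s (subst (_≤ t + c + suc k * suc (t + c)) (ℕ.+-assoc t c _)
  (ℕ.+-monoʳ-≤ (t + c) (whileCost-bound t c k)))

-- Restricted to `1 ≤ n`, because `n ^ d` vanishes at 0 for positive `d` while the costs do not.
Poly : ℕ → (ℕ → ℕ) → Set
Poly d f = ∃[ C ] (∀ n → 1 ≤ n → f n ≤ C * n ^ d)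

1≤n^ : ∀ {n} d → 1 ≤ n → 1 ≤ n ^ d
1≤n^ zero    1≤n = ℕ.≤-refl
1≤n^ (suc d) 1≤n = ℕ.*-mono-≤ 1≤n (1≤n^ d 1≤n)

poly-const : ∀ d c → Poly d (λ _ → c)
poly-const d c = c , λ n 1≤n → subst (_≤ c * n ^ d) (ℕ.*-identityʳ c) (ℕ.*-monoʳ-≤ c (1≤n^ d 1≤n))

poly-id : ∀ d → Poly (suc d) (λ n → n)
poly-id d = 1 , λ n 1≤n → subst (n ≤_) (sym (ℕ.*-identityˡ (n ^ suc d)))
  (subst (_≤ n ^ suc d) (ℕ.*-identityʳ n) (ℕ.*-monoʳ-≤ n (1≤n^ d 1≤n)))

poly-+ : ∀ d f g → Poly d f → Poly d g → Poly d (λ n → f n + g n)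
poly-+ d f g (C , f≤) (C′ , g≤) = C + C′ , λ n 1≤n →
  subst (f n + g n ≤_) (sym (ℕ.*-distribʳ-+ (n ^ d) C C′)) (ℕ.+-mono-≤ (f≤ n 1≤n) (g≤ n 1≤n))

poly-* : ∀ d e f g → Poly d f → Poly e g → Poly (d + e) (λ n → f n * g n)
poly-* d e f g (C , f≤) (C′ , g≤) = C * C′ , λ n 1≤n → subst (f n * g n ≤_)
  (trans (ℕ.[m*n]*[o*p]≡[m*o]*[n*p] C (n ^ d) C′ (n ^ e))
    (cong (C * C′ *_) (sym (ℕ.^-distribˡ-+-* n d e))))
  (ℕ.*-mono-≤ (f≤ n 1≤n) (g≤ n 1≤n))

poly-suc : ∀ d f → Poly d f → Poly d (λ n → suc (f n))
poly-suc d f = poly-+ d (λ _ → 1) f (poly-const d 1)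

poly-while : ∀ d t c k → Poly d c → Poly 1 k → Poly (suc d) (λ n → whileCost t (c n) (k n))
poly-while d t c k pc pk =
  let C , bound = poly-* 1 d (λ n → suc (k n)) (λ n → suc t + c n) (poly-suc 1 k pk)
                    (poly-+ d (λ _ → suc t) c (poly-const d (suc t)) pc)
  in C , λ n 1≤n → ℕ.≤-trans (whileCost-bound t (c n) (k n)) (bound n 1≤n)

poly-for : ∀ d v b c k → Poly d c → Poly 1 k → Poly (suc d) (λ n → forCost v b (c n) (k n))
poly-for d v b c k pc pk =
  poly-+ (suc d) (λ _ → init) (λ n → whileCost test (c n + next) (k n)) (poly-const (suc d) init)
    (poly-while d test (λ n → c n + next) k (poly-+ d c (λ _ → next) pc (poly-const d next)) pk)
  where
  init = assignCost (varʷ v) (lit 0)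
  next = assignCost (varʷ v) (get v +ʷ lit 1)
  test = costᵗ (get v +ʷ lit 1 ≤ʷ b)

poly⇒∈O : ∀ {d f} → Poly d f → f ∈O (λ n → n ^ d)
poly⇒∈O (C , bound) = C , 1 , bound

-- The body of the innermost loop has constant cost and each of the four loops adds one degree. The
-- trace is linear and is merely rated at the same degree.
time∈O : time ∈O (λ n → n ^ 4)
time∈O = poly⇒∈O {4}
  (poly-+ 4 (λ _ → initCost) (λ n → fillCost n + (traceCost n + finishCost)) (poly-const 4 initCost)
    (poly-+ 4 fillCost (λ n → traceCost n + finishCost)
      (poly-for 3 rᵛ nʷ kCost (λ n → n)
        (poly-for 2 kᵛ Nʷ lCost suc
          (poly-for 1 lᵛ Nʷ mCost suc
            (poly-for 0 mᵛ nʷ (λ _ → extendCost) (λ n → n) (poly-const 0 extendCost) (poly-id 0))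
            pN) pN) (poly-id 0))
      (poly-+ 4 traceCost (λ _ → finishCost)
        (poly-while 3 (costᵗ (lit 1 ≤ʷ get Rᵛ)) (λ _ → traceStepCost) (λ n → n)
          (poly-const 3 traceStepCost) (poly-id 0))
        (poly-const 4 finishCost))))
  where
  pN : Poly 1 suc
  pN = poly-suc 1 (λ n → n) (poly-id 0)

space∈O : space ∈O (λ n → n ^ 3)
space∈O = poly⇒∈O {3}
  (poly-+ 3 suc (λ n → 7 + tableSize n) (poly-suc 3 (λ n → n) (poly-id 2))
    (poly-+ 3 (λ _ → 7) tableSize (poly-const 3 7)
      (poly-* 1 2 suc (λ n → suc n * suc n) pN (poly-* 1 1 suc suc pN pN))))
  where
  pN : Poly 1 suc
  pN = poly-suc 1 (λ n → n) (poly-id 0)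

-- The padded input and the placement of marks

abstract
  fits : ∀ n → inputSize n ≤ space n
  fits n = ℕ.≤-trans (ℕ.≤-reflexive 3+n+n≡) (ℕ.+-monoʳ-≤ (suc n) (ℕ.+-mono-≤ {2} {7} (s≤s (s≤s z≤n)) n≤))
    where
    3+n+n≡ : inputSize n ≡ suc n + (2 + n)
    3+n+n≡ = cong suc (trans (cong suc (sym (ℕ.+-suc n n))) (sym (ℕ.+-suc n (suc n))))
    n≤ : n ≤ tableSize n
    n≤ = ℕ.≤-trans (ℕ.n≤1+n n) (ℕ.m≤m*n (suc n) (suc n * suc n))

lookup-padRight : ∀ {A : Set} {m n} (m≤n : m ≤ n) (a : A) (xs : Vec A m) (i : Fin m) (j : Fin n) →
                  toℕ j ≡ toℕ i → lookup (padRight m≤n a xs) j ≡ lookup xs i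
lookup-padRight (s≤s m≤n) a (x ∷ xs) zero    zero    _  = refl
lookup-padRight (s≤s m≤n) a (x ∷ xs) (suc i) (suc j) eq =
  lookup-padRight m≤n a xs i j (ℕ.suc-injective eq)

lookup-padRight-beyond : ∀ {A : Set} {m n} (m≤n : m ≤ n) (a : A) (xs : Vec A m) (j : Fin n) →
                         m ≤ toℕ j → lookup (padRight m≤n a xs) j ≡ a
lookup-padRight-beyond z≤n       a []       j       _         = lookup-replicate j a
lookup-padRight-beyond (s≤s m≤n) a (x ∷ xs) (suc j) (s≤s m≤j) =
  lookup-padRight-beyond m≤n a xs j m≤j

-- `suc (mark i)` is the word that marks disk `i` during the trace.
mark : ∀ {n} → Fin n → Fin n
mark {suc n} zero    = fromℕ n
mark {suc n} (suc i) = inject₁ i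

mark-injective : ∀ {n} (i j : Fin n) → mark i ≡ mark j → i ≡ j
mark-injective zero    zero    _  = refl
mark-injective zero    (suc j) eq = ⊥-elim (Fin.fromℕ≢inject₁ eq)
mark-injective (suc i) zero    eq = ⊥-elim (Fin.fromℕ≢inject₁ (sym eq))
mark-injective (suc i) (suc j) eq = cong suc (Fin.inject₁-injective eq)

-- `1 ∸ toℕ i` is 1 for disk 0 and 0 otherwise, so `n` is added for disk 0 alone, without a branch.
mark-address : ∀ {n} (i : Fin n) → toℕ i + n * (1 ∸ toℕ i) ≡ suc (toℕ (mark i))
mark-address {suc n} zero    = trans (ℕ.*-identityʳ (suc n)) (cong suc (sym (Fin.toℕ-fromℕ n)))
mark-address {suc n} (suc i) = trans
  (cong (suc (toℕ i) +_) (trans (cong (suc n *_) (ℕ.0∸n≡0 (toℕ i))) (ℕ.*-zeroʳ (suc n))))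
  (trans (ℕ.+-identityʳ _) (cong suc (sym (Fin.toℕ-inject₁ i))))

-- Disks other than 0 are marked in their output word already; only the mark of disk 0 must be
-- moved.
mark-position : ∀ {n} (i : Fin n) → (inject₁ i ≡ zero × suc (mark i) ≡ fromℕ n) ⊎
                                    ∃[ j ] (inject₁ i ≡ suc j × suc (mark i) ≡ suc j)
mark-position {suc n} zero    = inj₁ (refl , refl)
mark-position {suc n} (suc i) = inj₂ (inject₁ i , refl , refl)

-- Correctness: evaluation of the geometric tests

module Correctness (ℝ : RealNumbers) (n : ℕ)
  (L : Plane.Line ℝ) (D : Plane.Disks ℝ n)
  (intersects : Plane.AllIntersect ℝ D L) (oneSided : Plane.CentersOnOneSide ℝ D L) where

  open RealNumbers ℝ using (Carrier; 0#; _≤?_) renaming (_≤_ to _≤ᵣ_)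
  open Plane ℝ
  open Geometry ℝ
  open Strip D L intersects oneSided
  open Line L
  open RealRAM ℝ (space n)
  open InputOutput ℝ n (fits n)
  open Graph (intersectionGraph D) using (Adj; symm)

  order : ChainOrder Adj
  order = record
    { Adj-sym = symm
    ; _⊑_     = _⊑_
    ; _≺_     = _≺_
    ; ⊑-total = ⊑-total
    ; ⊑-trans = λ {i} {j} {k} → ⊑-trans {i} {j} {k}
    ; ≺⇒⊑     = proj₁
    ; ≺⇒⋣     = ≺⇒⋣
    ; ≺-trans = ≺-trans
    ; ≺⇒¬Adj  = ≺⇒¬Adj
    ; ¬Adj⇒≺  = ¬Adj⇒≺
    }

  open Positions n using (Index; Position)
  open TwoChains order

  abscissae ordinates : Vec Carrier n
  abscissae = tabulate (λ i → x (D i))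
  ordinates = tabulate (λ i → y (D i))

  ρ : Vec Carrier (space n)
  ρ = reals (initial L D)

  open Logic ℝ n ρ

  ρ-lookup : ∀ i j → toℕ j ≡ toℕ i → lookup ρ j ≡ lookup (a ∷ b ∷ c ∷ (abscissae ++ ordinates)) i
  ρ-lookup = lookup-padRight (fits n) 0# (a ∷ b ∷ c ∷ (abscissae ++ ordinates))

  2+n< : 2 + n < space n
  2+n< = subst (_< space n) (ℕ.+-comm n 2) (n+small (s≤s (s≤s z≤n)))

  x-bound : ∀ (k : Index) → 2 + toℕ k < space n
  x-bound k = ℕ.≤-<-trans (ℕ.+-monoʳ-≤ 2 (Fin.toℕ≤pred[n] k)) 2+n<

  y-bound : ∀ (k : Index) → 2 + n + toℕ k < space n
  y-bound k = ℕ.≤-trans (s≤s (ℕ.+-monoʳ-≤ (2 + n) (Fin.toℕ≤pred[n] k))) (fits n)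

  x-cell y-cell : Index → Word
  x-cell k = fromℕ< (x-bound k)
  y-cell k = fromℕ< (y-bound k)

  x-cell-toℕ : ∀ k → toℕ (x-cell k) ≡ 2 + toℕ k
  x-cell-toℕ k = Fin.toℕ-fromℕ< (x-bound k)

  y-cell-toℕ : ∀ k → toℕ (y-cell k) ≡ 2 + n + toℕ k
  y-cell-toℕ k = Fin.toℕ-fromℕ< (y-bound k)

  -- `point zero` is not a center but whatever the input holds there: `∧ᵗ` evaluates both sides, so
  -- coordinates are read even for the bottom. The guard `1 ≤ toℕ k` then overrides the comparison.
  point : Index → Point
  point k = ⟨ lookup ρ (x-cell k) , lookup ρ (y-cell k) ⟩

  point-disk : ∀ i → point (suc i) ≡ D i
  point-disk i = cong₂ ⟨_,_⟩
    (trans (ρ-lookup (suc (suc (suc (i ↑ˡ n)))) _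
              (trans (x-cell-toℕ (suc i)) (cong (3 +_) (sym (Fin.toℕ-↑ˡ i n)))))
      (trans (lookup-++ˡ abscissae ordinates i) (lookup∘tabulate _ i)))
    (trans (ρ-lookup (suc (suc (suc (n ↑ʳ i)))) _
              (trans (y-cell-toℕ (suc i))
                (cong (2 +_) (trans (ℕ.+-suc n _) (cong suc (sym (Fin.toℕ-↑ʳ n i)))))))
      (trans (lookup-++ʳ abscissae ordinates i) (lookup∘tabulate _ i)))

  ⇓ʳ-cong : ∀ {A e r s} → r ≡ s → A ⊢ e ⇓ʳ r → A ⊢ e ⇓ʳ s
  ⇓ʳ-cong refl e⇓ = e⇓

  -- `map′` keeps the Boolean, so a test can be tied to the intended proposition instead of its
  -- encoding.
  map⇓ : ∀ {A t P Q} {P? : Dec P} {to : P → Q} {from : Q → P} → A ⊢ t ⇓ᵗ P? → A ⊢ t ⇓ᵗ map′ to from P?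
  map⇓ (⇓ᵗ t⇓) = ⇓ᵗ t⇓

  lit⇓′ : ∀ {A} v → v ≤ 8 → A ⊢ lit v ⇓ v
  lit⇓′ v v≤8 = lit⇓ (small v≤8)

  suc⇓ : ∀ {A e v} → A ⊢ e ⇓ v → v ≤ n → A ⊢ e +ʷ lit 1 ⇓ suc v
  suc⇓ {v = v} e⇓ v≤n = ⇓-cong (ℕ.+-comm v 1)
    (+⇓ e⇓ (lit⇓′ 1 (s≤s z≤n)) (ℕ.≤-<-trans (ℕ.+-monoˡ-≤ 1 v≤n) (n+small (s≤s z≤n))))

  module _ {A : Contents} (A≡n : A base ≡ n) where

    xʳ⇓ : ∀ {e} k → A ⊢ e ⇓ toℕ k → A ⊢ xʳ e ⇓ʳ x (point k)
    xʳ⇓ k e⇓ = real⇓ʳ (x-cell k) (⇓-cong (sym (x-cell-toℕ k))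
      (+⇓ (lit⇓′ 2 (s≤s (s≤s z≤n))) e⇓ (x-bound k)))

    yʳ⇓ : ∀ {e} k → A ⊢ e ⇓ toℕ k → A ⊢ yʳ e ⇓ʳ y (point k)
    yʳ⇓ k e⇓ = real⇓ʳ (y-cell k) (⇓-cong (sym (y-cell-toℕ k))
      (+⇓ (+⇓ (lit⇓′ 2 (s≤s (s≤s z≤n))) (nʷ⇓ A≡n) 2+n<)
          e⇓ (y-bound k)))

    keyʳ⇓ : ∀ {e} k → A ⊢ e ⇓ toℕ k → A ⊢ keyʳ e ⇓ʳ key (point k)
    keyʳ⇓ k e⇓ = -ʳ⇓ (*ʳ⇓ b⇓ (xʳ⇓ k e⇓)) (*ʳ⇓ a⇓ (yʳ⇓ k e⇓))
      where
      b-cell : Word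
      b-cell = fromℕ< (small {1} (s≤s z≤n))
      b-cell≡ : toℕ b-cell ≡ 1
      b-cell≡ = Fin.toℕ-fromℕ< (small {1} (s≤s z≤n))
      a⇓ : A ⊢ real[ lit 0 ] ⇓ʳ a
      a⇓ = ⇓ʳ-cong (ρ-lookup zero zero refl) (real⇓ʳ zero (lit⇓′ 0 z≤n))
      b⇓ : A ⊢ real[ lit 1 ] ⇓ʳ b
      b⇓ = ⇓ʳ-cong (ρ-lookup (suc zero) b-cell b-cell≡)
        (real⇓ʳ b-cell (⇓-cong (sym b-cell≡) (lit⇓′ 1 (s≤s z≤n))))

    dist²ʳ⇓ : ∀ {e f} k l → A ⊢ e ⇓ toℕ k → A ⊢ f ⇓ toℕ l → A ⊢ dist²ʳ e f ⇓ʳ dist² (point k) (point l)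
    dist²ʳ⇓ k l e⇓ f⇓ = +ʳ⇓ (*ʳ⇓ Δx Δx) (*ʳ⇓ Δy Δy)
      where
      Δx = -ʳ⇓ (xʳ⇓ k e⇓) (xʳ⇓ l f⇓)
      Δy = -ʳ⇓ (yʳ⇓ k e⇓) (yʳ⇓ l f⇓)

    4ʳ⇓ : A ⊢ (1ʳ +ʳ 1ʳ) *ʳ (1ʳ +ʳ 1ʳ) ⇓ʳ 4#
    4ʳ⇓ = *ʳ⇓ (+ʳ⇓ 1ʳ⇓ 1ʳ⇓) (+ʳ⇓ 1ʳ⇓ 1ʳ⇓)

  -- Mirrors how `precedesᵗ` and `beforeᵗ` encode that `k` is the bottom or `P` holds.
  or-bottom : ∀ {P : Set} k → Dec P → Dec (¬ (1 ≤ toℕ {suc n} k × ¬ P))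
  or-bottom k P? = ¬? ((1 ℕ.≤? toℕ k) ×-dec ¬? P?)

  Along Apart : Point → Point → Set
  Along p q = key p ≤ᵣ key q
  Apart p q = Along p q × ¬ dist² p q ≤ᵣ 4#

  apart? : ∀ p q → Dec (Apart p q)
  apart? p q = (key p ≤? key q) ×-dec ¬? (dist² p q ≤? 4#)

  precedes? : ∀ k m → Dec (k ≺₀ m)
  precedes? k m = map′ (to k) (from k) (or-bottom k (apart? (point k) (point (suc m))))
    where
    to : ∀ k → ¬ (1 ≤ toℕ k × ¬ Apart (point k) (point (suc m))) → k ≺₀ m
    to zero    _   = tt
    to (suc i) ¬¬P = subst₂ Apart (point-disk i) (point-disk m)
      (decidable-stable (apart? (point (suc i)) (point (suc m))) λ ¬P → ¬¬P (s≤s z≤n , ¬P))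
    from : ∀ k → k ≺₀ m → ¬ (1 ≤ toℕ k × ¬ Apart (point k) (point (suc m)))
    from zero    _   (() , _)
    from (suc i) i≺m (_ , ¬P) = ¬P (subst₂ Apart (sym (point-disk i)) (sym (point-disk m)) i≺m)

  Before : Index → Index → Set
  Before k l = Along (point k) (point l) × ¬ (toℕ k ≤ toℕ l × toℕ l ≤ toℕ k)

  before-index? : ∀ k l → Dec (Before k l)
  before-index? k l = (key (point k) ≤? key (point l)) ×-dec
    ¬? ((toℕ k ℕ.≤? toℕ l) ×-dec (toℕ l ℕ.≤? toℕ k))

  before? : ∀ k m → Dec (k ⊏₀ m)
  before? k m = map′ (to k) (from k) (or-bottom k (before-index? k (suc m)))
    where
    to : ∀ k → ¬ (1 ≤ toℕ k × ¬ Before k (suc m)) → k ⊏₀ m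
    to zero    _   = tt
    to (suc i) ¬¬P =
      let along , distinct = decidable-stable (before-index? (suc i) (suc m)) λ ¬P → ¬¬P (s≤s z≤n , ¬P)
      in subst₂ Along (point-disk i) (point-disk m) along , λ { refl → distinct (ℕ.≤-refl , ℕ.≤-refl) }
    from : ∀ k → k ⊏₀ m → ¬ (1 ≤ toℕ k × ¬ Before k (suc m))
    from zero    _           (() , _)
    from (suc i) (i⊑m , i≢m) (_ , ¬P) = ¬P
      ( subst₂ Along (sym (point-disk i)) (sym (point-disk m)) i⊑m
      , λ { (s≤s i≤m , s≤s m≤i) → i≢m (Fin.toℕ-injective (ℕ.≤-antisym i≤m m≤i)) })

  precedes⇓ : ∀ {A e f} → A base ≡ n → ∀ k m → A ⊢ e ⇓ toℕ k → A ⊢ f ⇓ suc (toℕ m) →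
              A ⊢ precedesᵗ e f ⇓ᵗ precedes? k m
  precedes⇓ A≡n k m e⇓ f⇓ = map⇓ (not⇓ (∧⇓ (≤ʷ⇓ (lit⇓′ 1 (s≤s z≤n)) e⇓) (not⇓
    (∧⇓ (≤ʳ⇓ (keyʳ⇓ A≡n k e⇓) (keyʳ⇓ A≡n (suc m) f⇓))
        (not⇓ (≤ʳ⇓ (dist²ʳ⇓ A≡n k (suc m) e⇓ f⇓) (4ʳ⇓ A≡n)))))))

  before⇓ : ∀ {A e f} → A base ≡ n → ∀ k m → A ⊢ e ⇓ toℕ k → A ⊢ f ⇓ suc (toℕ m) →
            A ⊢ beforeᵗ e f ⇓ᵗ before? k m
  before⇓ A≡n k m e⇓ f⇓ = map⇓ (not⇓ (∧⇓ (≤ʷ⇓ (lit⇓′ 1 (s≤s z≤n)) e⇓) (not⇓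
    (∧⇓ (≤ʳ⇓ (keyʳ⇓ A≡n k e⇓) (keyʳ⇓ A≡n (suc m) f⇓))
        (not⇓ (∧⇓ (≤ʷ⇓ e⇓ f⇓) (≤ʷ⇓ f⇓ e⇓)))))))

  reached? : ∀ T r k l → Dec (Reached T (r , k , l))
  reached? T r k l = map′ to from (¬? (¬? (1 ℕ.≤? T (r , k , l)) ×-dec ¬? (1 ℕ.≤? T (r , l , k))))
    where
    to : ¬ (¬ 1 ≤ T (r , k , l) × ¬ 1 ≤ T (r , l , k)) → Reached T (r , k , l)
    to ¬¬ with 1 ℕ.≤? T (r , k , l)
    ... | yes filled = inj₁ filled
    ... | no  empty  = inj₂ (decidable-stable (1 ℕ.≤? T (r , l , k)) λ empty′ → ¬¬ (empty , empty′))
    from : Reached T (r , k , l) → ¬ (¬ 1 ≤ T (r , k , l) × ¬ 1 ≤ T (r , l , k))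
    from (inj₁ filled) (empty , _) = empty filled
    from (inj₂ filled) (_ , empty) = empty filled

  tbl-get⇓ : ∀ {A e f g} r k l → A base ≡ n → A ⊢ e ⇓ toℕ r → A ⊢ f ⇓ toℕ k → A ⊢ g ⇓ toℕ l →
             A ⊢ word[ tblʷ e f g ] ⇓ table A (r , k , l)
  tbl-get⇓ r k l A≡n e⇓ f⇓ g⇓ = cell⇓ (tbl (r , k , l)) (tblʷ⇓ r k l A≡n e⇓ f⇓ g⇓)

  set-run : ∀ {A e v} w → A base ≡ n → A ⊢ e ⇓ v →
            Run (word[ varʷ w ]≔ e) A (assignCost (varʷ w) e) (A [ var w ↦ v ])
  set-run w A≡n e⇓ = assign-run (var w) (varʷ⇓ w A≡n) e⇓

  Best : Contents → Position → Set
  Best A (r , k , l) = A (var Rᵛ) ≡ toℕ r × A (var Kᵛ) ≡ toℕ k × A (var Lᵛ) ≡ toℕ l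

  -- `t` counts the executions of `extend` so far, and `bound` limits the size of the best entry.
  -- The marks are kept at zero for the trace.
  Filling : ℕ → ℕ → Contents → Set
  Filling t bound A = A base ≡ n × (∀ j → A (low (suc j)) ≡ 0) ×
    ∃[ best ] (Best A best × toℕ (proj₁ best) ≤ bound × Sound (table A) best × DoneBelow (table A) t)

  Counters : Contents → ℕ → ℕ → ℕ → Set
  Counters A r k l = A (var rᵛ) ≡ r × A (var kᵛ) ≡ k × A (var lᵛ) ≡ l

  extend-reaches : ∀ r k l m {A} → A (var mᵛ) ≡ toℕ m → Counters A (toℕ r) (toℕ k) (toℕ l) →
                   Filling (rank r k l m) (suc (toℕ r)) A →
                   Reaches extend A extendCost λ B → B (var mᵛ) ≡ toℕ m ×
                     Counters B (toℕ r) (toℕ k) (toℕ l) × Filling (suc (rank r k l m)) (suc (toℕ r)) B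
  extend-reaches r k l m {A} m≡ (r≡ , k≡ , l≡) (A≡n , clean , best , bests , best≤ , sound , below) =
    by-cases (reached? (table A) (inject₁ r) k l ×-dec (precedes? k m ×-dec before? l m)) test⇓
    where
    Condition : Set
    Condition = Reached (table A) (inject₁ r , k , l) × k ≺₀ m × l ⊏₀ m

    r⇓ : A ⊢ get rᵛ ⇓ toℕ (inject₁ r)
    r⇓ = get⇓ rᵛ A≡n (trans r≡ (sym (Fin.toℕ-inject₁ r)))
    k⇓ : A ⊢ get kᵛ ⇓ toℕ k
    k⇓ = get⇓ kᵛ A≡n k≡
    l⇓ : A ⊢ get lᵛ ⇓ toℕ l
    l⇓ = get⇓ lᵛ A≡n l≡
    m⇓ : A ⊢ get mᵛ +ʷ lit 1 ⇓ suc (toℕ m)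
    m⇓ = suc⇓ (get⇓ mᵛ A≡n m≡) (Fin.toℕ≤n m)

    test⇓ : A ⊢ extendᵗ ⇓ᵗ (reached? (table A) (inject₁ r) k l ×-dec (precedes? k m ×-dec before? l m))
    test⇓ = ∧⇓
      (map⇓ (not⇓ (∧⇓ (not⇓ (≤ʷ⇓ (lit⇓′ 1 (s≤s z≤n)) (tbl-get⇓ (inject₁ r) k l A≡n r⇓ k⇓ l⇓)))
                      (not⇓ (≤ʷ⇓ (lit⇓′ 1 (s≤s z≤n)) (tbl-get⇓ (inject₁ r) l k A≡n r⇓ l⇓ k⇓))))))
      (∧⇓ (precedes⇓ A≡n k m k⇓ m⇓) (before⇓ A≡n l m l⇓ m⇓))

    record-run : Run record-extension A recordCost
      (A [ tbl (suc r , suc m , l) ↦ suc (toℕ k) ] [ var Rᵛ ↦ suc (toℕ r) ]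
         [ var Kᵛ ↦ suc (toℕ m) ] [ var Lᵛ ↦ toℕ l ])
    record-run =
      assign-run (tbl (suc r , suc m , l))
        (tblʷ⇓ (suc r) (suc m) l A≡n (suc⇓ (get⇓ rᵛ A≡n r≡) (Fin.toℕ≤n r)) m⇓ l⇓)
        (suc⇓ k⇓ (Fin.toℕ≤pred[n] k))
      then-run set-run Rᵛ A≡n (suc⇓ (get⇓ rᵛ A≡n r≡) (Fin.toℕ≤n r))
      then-run set-run Kᵛ A≡n (suc⇓ (get⇓ mᵛ A≡n m≡) (Fin.toℕ≤n m))
      then-run set-run Lᵛ A≡n (get⇓ lᵛ A≡n l≡)

    by-cases : (d : Dec Condition) → A ⊢ extendᵗ ⇓ᵗ d →
               Reaches extend A extendCost λ B → B (var mᵛ) ≡ toℕ m ×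
                 Counters B (toℕ r) (toℕ k) (toℕ l) × Filling (suc (rank r k l m)) (suc (toℕ r)) B
    by-cases (yes (reached , k≺m , l⊏m)) t⇓ =
      _ , if-true-run {c = recordCost} 1 t⇓ (reached , k≺m , l⊏m) record-run , m≡ , (r≡ , k≡ , l≡) ,
      A≡n , clean , W.new , (refl , refl , refl) , ℕ.≤-refl , W.sound′ , W.doneBelow′ below
      where module W = Write (table A) best r k l m sound best≤ reached k≺m l⊏m
    by-cases (no ¬condition) t⇓ =
      _ , if-false-run {c = 1} recordCost t⇓ ¬condition skip-run , m≡ , (r≡ , k≡ , l≡) ,
      A≡n , clean , best , bests , best≤ , sound ,
      doneBelow-suc {table A} r k l m below (λ reached k≺m l⊏m →
        ⊥-elim (¬condition (reached , k≺m , l⊏m)))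

  -- The nested loops that fill the table

  lCount kCount rCount : ℕ
  lCount = n
  kCount = N * n
  rCount = N * (N * n)

  -- The weights are the numbers of executions of `extend` per value of a counter, so ranks can be
  -- followed loop by loop.
  rank-expand : ∀ r k l m → rank r k l m ≡ rCount * toℕ r + kCount * toℕ k + lCount * toℕ l + toℕ m
  rank-expand r k l m = trans (Fin.toℕ-combine r _)
    (trans (cong (rCount * toℕ r +_) (trans (Fin.toℕ-combine k _)
      (trans (cong (kCount * toℕ k +_) (Fin.toℕ-combine l m)) (sym (ℕ.+-assoc (kCount * toℕ k) _ _)))))
    (trans (sym (ℕ.+-assoc (rCount * toℕ r) _ _))
      (cong (_+ toℕ m) (sym (ℕ.+-assoc (rCount * toℕ r) _ _)))))

  next-count : ∀ t c i → t + c * i + c ≡ t + c * suc i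
  next-count t c i = trans (ℕ.+-assoc t (c * i) c)
    (cong (t +_) (trans (ℕ.+-comm (c * i) c) (sym (ℕ.*-suc c i))))

  first-count : ∀ t c → t ≡ t + c * 0
  first-count t c = sym (trans (cong (t +_) (ℕ.*-zeroʳ c)) (ℕ.+-identityʳ t))

  filling-≡ : ∀ {t u bound A} → t ≡ u → Filling t bound A → Filling u bound A
  filling-≡ refl filling = filling

  N+1< : N + 1 < space n
  N+1< = subst (_< space n) (trans (ℕ.+-comm n 2) (sym (ℕ.+-comm N 1))) (n+small (s≤s (s≤s z≤n)))

  n+1< : n + 1 < space n
  n+1< = n+small (s≤s z≤n)

  MInv : Fin n → Index → Index → ℕ → Contents → Set
  MInv r k l i A = Counters A (toℕ r) (toℕ k) (toℕ l) ×
    Filling (rCount * toℕ r + kCount * toℕ k + lCount * toℕ l + i) (suc (toℕ r)) A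

  LInv : Fin n → Index → ℕ → Contents → Set
  LInv r k i A = A (var rᵛ) ≡ toℕ r × A (var kᵛ) ≡ toℕ k ×
    Filling (rCount * toℕ r + kCount * toℕ k + lCount * i) (suc (toℕ r)) A

  KInv : Fin n → ℕ → Contents → Set
  KInv r i A = A (var rᵛ) ≡ toℕ r × Filling (rCount * toℕ r + kCount * i) (suc (toℕ r)) A

  RInv : ℕ → Contents → Set
  RInv i A = Filling (rCount * i) i A

  m-body : ∀ r k l (m : Fin n) {A} → A (var mᵛ) ≡ toℕ m → MInv r k l (toℕ m) A →
           Reaches extend A extendCost λ B → B (var mᵛ) ≡ toℕ m × MInv r k l (suc (toℕ m)) B
  m-body r k l m {A} m≡ (counters , filling) =
    let B , run , m≡′ , counters′ , filling′ =
          extend-reaches r k l m {A} m≡ counters (filling-≡ {A = A} (sym (rank-expand r k l m)) filling)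
    in B , run , m≡′ , counters′ ,
       filling-≡ {A = B} (trans (cong suc (rank-expand r k l m)) (sym (ℕ.+-suc _ (toℕ m)))) filling′

  m-loop : ∀ r k l {A} → MInv r k l 0 A → Reaches (for mᵛ nʷ extend) A (mCost n) (MInv r k l n)
  m-loop r k l = for-reaches {nʷ} {extend} {extendCost} {n} mᵛ (MInv r k l)
    (λ (_ , A≡n , _) → A≡n) (λ (_ , A≡n , _) → nʷ⇓ A≡n) (λ inv → inv) n+1< (m-body r k l)

  l-body : ∀ r k (l : Index) {A} → A (var lᵛ) ≡ toℕ l → LInv r k (toℕ l) A →
           Reaches (for mᵛ nʷ extend) A (mCost n) λ B → B (var lᵛ) ≡ toℕ l × LInv r k (suc (toℕ l)) B
  l-body r k l {A} l≡ (r≡ , k≡ , filling) =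
    let B , run , (r≡′ , k≡′ , l≡′) , filling′ =
          m-loop r k l {A} ((r≡ , k≡ , l≡) , filling-≡ {A = A} (sym (ℕ.+-identityʳ _)) filling)
    in B , run , l≡′ , r≡′ , k≡′ ,
       filling-≡ {A = B} (next-count (rCount * toℕ r + kCount * toℕ k) lCount (toℕ l)) filling′

  l-loop : ∀ r k {A} → LInv r k 0 A → Reaches (for lᵛ Nʷ (for mᵛ nʷ extend)) A (lCost n) (LInv r k N)
  l-loop r k = for-reaches {Nʷ} {for mᵛ nʷ extend} {mCost n} {N} lᵛ (LInv r k)
    (λ (_ , _ , A≡n , _) → A≡n) (λ (_ , _ , A≡n , _) → Nʷ⇓ A≡n) (λ inv → inv) N+1< (l-body r k)

  k-body : ∀ r (k : Index) {A} → A (var kᵛ) ≡ toℕ k → KInv r (toℕ k) A →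
           Reaches (for lᵛ Nʷ (for mᵛ nʷ extend)) A (lCost n) λ B →
             B (var kᵛ) ≡ toℕ k × KInv r (suc (toℕ k)) B
  k-body r k {A} k≡ (r≡ , filling) =
    let B , run , r≡′ , k≡′ , filling′ =
          l-loop r k {A} (r≡ , k≡ ,
            filling-≡ {A = A} (first-count (rCount * toℕ r + kCount * toℕ k) lCount) filling)
    in B , run , k≡′ , r≡′ , filling-≡ {A = B}
         (trans (cong (rCount * toℕ r + kCount * toℕ k +_) (ℕ.*-comm n N))
                (next-count (rCount * toℕ r) kCount (toℕ k)))
         filling′

  k-loop : ∀ r {A} → KInv r 0 A →
           Reaches (for kᵛ Nʷ (for lᵛ Nʷ (for mᵛ nʷ extend))) A (kCost n) (KInv r N)
  k-loop r = for-reaches {Nʷ} {for lᵛ Nʷ (for mᵛ nʷ extend)} {lCost n} {N} kᵛ (KInv r)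
    (λ (_ , A≡n , _) → A≡n) (λ (_ , A≡n , _) → Nʷ⇓ A≡n) (λ inv → inv) N+1< (k-body r)

  r-body : ∀ (r : Fin n) {A} → A (var rᵛ) ≡ toℕ r → RInv (toℕ r) A →
           Reaches (for kᵛ Nʷ (for lᵛ Nʷ (for mᵛ nʷ extend))) A (kCost n) λ B →
             B (var rᵛ) ≡ toℕ r × RInv (suc (toℕ r)) B
  r-body r {A} r≡ (A≡n , clean , best , bests , best≤ , sound , below) =
    let B , run , r≡′ , filling′ =
          k-loop r {A} (r≡ , filling-≡ {A = A} (first-count (rCount * toℕ r) kCount)
            -- Turning to entries with `suc r` disks raises the limit on the best one from `r` to
            -- `suc r`.
            (A≡n , clean , best , bests , ℕ.m≤n⇒m≤1+n best≤ , sound , below))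
    in B , run , r≡′ , filling-≡ {A = B}
         (trans (cong (rCount * toℕ r +_) (ℕ.*-comm kCount N)) (next-count 0 rCount (toℕ r))) filling′

  fill-reaches : ∀ {A} → RInv 0 A → Reaches fill A (fillCost n) (RInv n)
  fill-reaches = for-reaches {nʷ} {for kᵛ Nʷ (for lᵛ Nʷ (for mᵛ nʷ extend))} {kCost n} {n} rᵛ RInv
    (λ (A≡n , _) → A≡n) (λ (A≡n , _) → nʷ⇓ A≡n) (λ inv → inv) n+1< r-body

  all-done : ∀ {T} → DoneBelow T (rCount * n) → ∀ r k l m → Done T r k l m
  all-done below r k l m =
    below r k l m (subst (rank r k l m <_) (ℕ.*-comm n rCount)
      (Fin.toℕ<n (combine r (combine k (combine l m)))))

  -- The trace and its marks

  bit : Subset n → Fin n → ℕ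
  bit s i = if lookup s i then 1 else 0

  Marked : Contents → Subset n → Set
  Marked A s = ∀ i → A (low (suc (mark i))) ≡ bit s i

  mark⇓ : ∀ {A e} (m : Fin n) → A base ≡ n → A ⊢ e ⇓ suc (toℕ m) →
          A ⊢ markʷ e ⇓ toℕ (address (low (suc (mark m))))
  mark⇓ {A} {e} m A≡n e⇓ = ⇓-cong address≡
    (+⇓ m⇓ (*⇓ (nʷ⇓ A≡n) (∸⇓ (lit⇓′ 1 (s≤s z≤n)) m⇓) (small-address (ℕ.m≤n+m _ (toℕ m))))
        (small-address ℕ.≤-refl))
    where
    m⇓ : A ⊢ e ∸ʷ lit 1 ⇓ toℕ m
    m⇓ = ∸⇓ e⇓ (lit⇓′ 1 (s≤s z≤n))
    address≡ : toℕ m + n * (1 ∸ toℕ m) ≡ toℕ (address (low (suc (mark m))))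
    address≡ = trans (mark-address m) (sym (Fin.toℕ-↑ˡ (suc (mark m)) _))
    small-address : ∀ {v} → v ≤ toℕ m + n * (1 ∸ toℕ m) → v < space n
    small-address v≤ = below-address (low (suc (mark m))) (ℕ.≤-trans v≤ (ℕ.≤-reflexive address≡))

  pop-run : ∀ {A} v w (r : Index) m l k → A base ≡ n → A (var Rᵛ) ≡ toℕ r → A (var v) ≡ suc (toℕ m) →
            A (var w) ≡ toℕ l → table A (r , suc m , l) ≡ suc k →
            Run (pop v w) A (popCost v w) (A [ low (suc (mark m)) ↦ 1 ] [ var v ↦ k ])
  pop-run {A} v w r m l k A≡n R≡ v≡ w≡ T≡ =
    assign-run (low (suc (mark m))) (mark⇓ m A≡n (get⇓ v A≡n v≡)) (lit⇓′ 1 (s≤s z≤n))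
    then-run set-run v A≡n (⇓-cong (cong (_∸ 1) T≡)
      (∸⇓ (tbl-get⇓ r (suc m) l A≡n (get⇓ Rᵛ A≡n R≡) (get⇓ v A≡n v≡) (get⇓ w A≡n w≡))
          (lit⇓′ 1 (s≤s z≤n))))

  marked-insert : ∀ {A s} m → Marked A s → Marked (A [ low (suc (mark m)) ↦ 1 ]) (s [ m ]≔ inside)
  marked-insert {A} {s} m marked i with m Fin.≟ i
  ... | yes refl = trans (update-same A (low (suc (mark m))) 1)
                         (sym (cong (if_then 1 else 0) (lookup∘update m s inside)))
  ... | no m≢i   = trans
    (update-other A (low (suc (mark m))) 1 λ eq →
      m≢i (mark-injective m i (Fin.suc-injective (low-injective eq))))
    (trans (marked i) (sym (cong (if_then 1 else 0) (lookup∘update′ (≢-sym m≢i) s inside))))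
    where
    low-injective : ∀ {i j} → low i ≡ low j → i ≡ j
    low-injective refl = refl

  module Trace (best : Position) where

    Tracing : ℕ → Contents → Set
    Tracing rest A = A base ≡ n × Sound (table A) best × ∃[ p ] ∃[ s ]
      (toℕ (proj₁ p) ≡ rest × Best A p × Partial (table A) p s × Marked A s ×
       rest + ∣ s ∣ ≡ toℕ (proj₁ best))

    popped-count : ∀ rest s {m : Fin n} {b} → m ∉ s → suc rest + ∣ s ∣ ≡ b →
                   rest + ∣ s [ m ]≔ inside ∣ ≡ b
    popped-count rest s m∉s eq = trans (cong (rest +_) (∣∣-insert s m∉s)) (trans (ℕ.+-suc rest ∣ s ∣) eq)

    trace-body : ∀ {rest A} → Tracing (suc rest) A →
                 Reaches (pop-branch ⨾ (word[ varʷ Rᵛ ]≔ get Rᵛ ∸ʷ lit 1)) A traceStepCost (Tracing rest)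
    trace-body {rest} {A}
      (A≡n , sound , (suc r , k , l) , s , r≡ , (R≡ , K≡ , L≡) , part , marked , count) =
      by-cases (1 ℕ.≤? table A (suc r , k , l)) (≤ʷ⇓ (lit⇓′ 1 (s≤s z≤n))
        (tbl-get⇓ (suc r) k l A≡n (get⇓ Rᵛ A≡n R≡) (get⇓ Kᵛ A≡n K≡) (get⇓ Lᵛ A≡n L≡)))
      where
      r≡′ : toℕ (inject₁ r) ≡ rest
      r≡′ = trans (Fin.toℕ-inject₁ r) (ℕ.suc-injective r≡)

      decrement : ∀ {B} → B base ≡ n → B (var Rᵛ) ≡ suc (toℕ r) →
                  Run (word[ varʷ Rᵛ ]≔ get Rᵛ ∸ʷ lit 1) B
                    (assignCost (varʷ Rᵛ) (get Rᵛ ∸ʷ lit 1)) (B [ var Rᵛ ↦ toℕ r ])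
      decrement B≡n B≡r = set-run Rᵛ B≡n (∸⇓ (get⇓ Rᵛ B≡n B≡r) (lit⇓′ 1 (s≤s z≤n)))

      branchᵗ : Test
      branchᵗ = lit 1 ≤ʷ word[ tblʷ (get Rᵛ) (get Kᵛ) (get Lᵛ) ]

      by-cases : (d : Dec (Filled (table A) (suc r , k , l))) → A ⊢ branchᵗ ⇓ᵗ d →
                 Reaches (pop-branch ⨾ (word[ varʷ Rᵛ ]≔ get Rᵛ ∸ʷ lit 1)) A traceStepCost (Tracing rest)
      by-cases (yes filled) t⇓ =
        let m , k′ , k≡ , T≡ , m∉s , part′ = partial-pop sound filled part in
        A [ low (suc (mark m)) ↦ 1 ] [ var Kᵛ ↦ toℕ k′ ] [ var Rᵛ ↦ toℕ r ] ,
        (if-true-run {c = popCost Kᵛ Lᵛ} (popCost Lᵛ Kᵛ) t⇓ filled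
          (pop-run Kᵛ Lᵛ (suc r) m l (toℕ k′) A≡n R≡ (trans K≡ (cong toℕ k≡)) L≡
            (trans (cong (λ k → table A (suc r , k , l)) (sym k≡)) T≡))
         then-run decrement A≡n R≡) ,
        A≡n , sound , (inject₁ r , k′ , l) , s [ m ]≔ inside , r≡′ ,
        (sym (Fin.toℕ-inject₁ r) , refl , L≡) , part′ , marked-insert {A} {s} m marked ,
        popped-count rest s m∉s count
      -- With this orientation empty, `Reached` leaves the swapped one, so the second chain is
      -- popped.
      by-cases (no empty) t⇓ =
        let m , l′ , l≡ , T≡ , m∉s , part′ = partial-pop sound filled (partial-swap part) in
        A [ low (suc (mark m)) ↦ 1 ] [ var Lᵛ ↦ toℕ l′ ] [ var Rᵛ ↦ toℕ r ] ,
        (if-false-run {c = popCost Lᵛ Kᵛ} (popCost Kᵛ Lᵛ) t⇓ empty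
          (pop-run Lᵛ Kᵛ (suc r) m k (toℕ l′) A≡n R≡ (trans L≡ (cong toℕ l≡)) K≡
            (trans (cong (λ l → table A (suc r , l , k)) (sym l≡)) T≡))
         then-run decrement A≡n R≡) ,
        A≡n , sound , (inject₁ r , k , l′) , s [ m ]≔ inside , r≡′ ,
        (sym (Fin.toℕ-inject₁ r) , K≡ , refl) , partial-swap part′ , marked-insert {A} {s} m marked ,
        popped-count rest s m∉s count
        where
        filled : Filled (table A) (suc r , l , k)
        filled = Sum.[ ⊥-elim ∘ empty , (λ f → f) ]′ (Partial.reached part)

    trace-test : ∀ {rest A} → Tracing rest A → WhileTest (lit 1 ≤ʷ get Rᵛ) A rest
    trace-test (A≡n , _ , _ , _ , r≡ , (R≡ , _) , _) = decides
      (≤ʷ⇓ (lit⇓′ 1 (s≤s z≤n)) (get⇓ Rᵛ A≡n (trans R≡ r≡))) (λ 1≤ → 1≤) (λ { refl () })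

    trace-reaches : ∀ rest {A} → Tracing rest A → Reaches trace A (traceCost rest) (Tracing 0)
    trace-reaches = while-reaches
      {lit 1 ≤ʷ get Rᵛ} {pop-branch ⨾ (word[ varʷ Rᵛ ]≔ get Rᵛ ∸ʷ lit 1)} {traceStepCost}
      Tracing (λ {k} {A} → trace-test {k} {A}) (λ {k} {A} → trace-body {k} {A})

  -- Initial memory, the whole run and the output

  initially : Contents
  initially (low zero) = n
  initially _          = 0

  initial≃ : initial L D ≃ initially
  initial≃ = record { contents = contents ; input = refl }
    where
    word : Fin (space n) → ℕ
    word j = toℕ (lookup (words (initial L D)) j)

    word-zero : ∀ j → toℕ j ≡ 0 → word j ≡ n
    word-zero j j≡0 = trans (cong toℕ (lookup-padRight 0<S _ _ zero j j≡0)) (Fin.toℕ-fromℕ< n<S)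

    word-suc : ∀ j → 1 ≤ toℕ j → word j ≡ 0
    word-suc j 1≤j = trans
      (cong toℕ (lookup-padRight-beyond 0<S (fromℕ< 0<S) (fromℕ< n<S ∷ []) j 1≤j)) (Fin.toℕ-fromℕ< 0<S)

    contents : ∀ c → word (address c) ≡ initially c
    contents (low zero)    = word-zero zero refl
    contents (low (suc j)) = word-suc (suc (j ↑ˡ _)) (s≤s z≤n)
    contents (var v)       = word-suc (address (var v)) (s≤s z≤n)
    contents (tbl p)       = word-suc (address (tbl p)) (s≤s z≤n)

  origin : Position
  origin = zero , zero , zero

  start : Contents
  start = initially [ tbl origin ↦ 1 ]

  start-run : Run (word[ tblʷ (lit 0) (lit 0) (lit 0) ]≔ lit 1) initially initCost start
  start-run = assign-run (tbl origin)
    (tblʷ⇓ zero zero zero refl (lit⇓′ 0 z≤n) (lit⇓′ 0 z≤n) (lit⇓′ 0 z≤n)) (lit⇓′ 1 (s≤s z≤n))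

  start-filling : RInv 0 start
  start-filling = refl , (λ _ → refl) , origin , (refl , refl , refl) , z≤n ,
    record
      { root        = s≤s z≤n
      ; justified   = λ p filled → subst (Justified (table start)) (only-origin p filled) (refl , refl)
      ; best-filled = s≤s z≤n
      ; best-max    = λ p filled → ℕ.≤-reflexive (cong (toℕ ∘ proj₁) (sym (only-origin p filled)))
      } ,
    λ r k l m rank< → ⊥-elim (ℕ.n≮0 (subst (rank r k l m <_) (ℕ.*-zeroʳ rCount) rank<))
    where
    only-origin : ∀ p → Filled (table start) p → origin ≡ p
    only-origin (zero  , zero  , zero)  _ = refl
    only-origin (zero  , zero  , suc _) ()
    only-origin (zero  , suc _ , _)     ()
    only-origin (suc _ , _     , _)     ()

  -- Each colour class is independent, so this makes `s` a union of two independent sets. Unlike a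
  -- `side` in `Bipartite`, the colouring is defined on all disks, so it needs no membership proofs.
  Independent : Subset n → Set
  Independent s = ∃[ colour ] Proper s colour

  Solution : Contents → Set
  Solution A = ∃[ s ] (Independent s × (∀ t → Independent t → ∣ t ∣ ≤ ∣ s ∣) ×
    ∀ i → A (low (inject₁ i)) ≡ bit s i)

  finish-reaches : ∀ {best A} → (∀ t → Independent t → ∣ t ∣ ≤ toℕ (proj₁ best)) →
                   Trace.Tracing best 0 A →
                   Reaches (word[ lit 0 ]≔ word[ nʷ ]) A finishCost Solution
  finish-reaches {best} {A} bound (A≡n , _ , _ , s , _ , _ , part , marked , count) =
    A [ base ↦ A (low (fromℕ n)) ] ,
    assign-run base (lit⇓′ 0 z≤n) (cell⇓ (low (fromℕ n))
      (⇓-cong (sym (trans (Fin.toℕ-↑ˡ (fromℕ n) _) (Fin.toℕ-fromℕ n))) (nʷ⇓ A≡n))) ,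
    s , (Partial.colour part , Partial.proper part) ,
    (λ t ind → subst (∣ t ∣ ≤_) (sym count) (bound t ind)) ,
    λ i → trans (moved i (mark-position i)) (marked i)
    where
    moved : ∀ i → (inject₁ i ≡ zero × suc (mark i) ≡ fromℕ n) ⊎
                  ∃[ j ] (inject₁ i ≡ suc j × suc (mark i) ≡ suc j) →
            (A [ base ↦ A (low (fromℕ n)) ]) (low (inject₁ i)) ≡ A (low (suc (mark i)))
    moved i (inj₁ (eq , eq′))     rewrite eq = cong (A ∘ low) (sym eq′)
    moved i (inj₂ (j , eq , eq′)) rewrite eq = cong (A ∘ low) (sym eq′)

  program-reaches : Reaches program initially (time n) Solution
  program-reaches =
    (start , start-run , start-filling) and-then λ {A} start-inv →
    fill-reaches {A} start-inv and-then λ {A} (A≡n , clean , best , bests , best≤ , sound , below) →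
    -- The trace takes one iteration per disk of the best entry, hence at most `n`.
    weaken (whileCost-mono (costᵗ (lit 1 ≤ʷ get Rᵛ)) traceStepCost best≤)
      (Trace.trace-reaches best (toℕ (proj₁ best)) {A}
        (A≡n , sound , best , ∅ , refl , bests , all-above sound ,
         (λ i → trans (clean (mark i)) (cong (if_then 1 else 0) (sym (lookup-replicate i outside)))) ,
         trans (cong (toℕ (proj₁ best) +_) (∣⊥∣≡0 n)) (ℕ.+-identityʳ _)))
    and-then λ {B} tracing →
    finish-reaches {best} {B}
      (λ { t (colour , proper) → size-bound sound (all-done {table A} below) t colour proper }) tracing
    where
    all-above : ∀ {T best} → Sound T best → Partial T best ∅
    all-above sound = record
      { colour  = λ _ → true
      ; proper  = λ i∈∅ → ⊥-elim (∉⊥ i∈∅)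
      ; reached = inj₁ (Sound.best-filled sound)
      ; above   = λ i∈∅ → ⊥-elim (∉⊥ i∈∅)
      }

  independent⇒bipartite : ∀ {s} → Independent s → InducesBipartite D s
  independent⇒bipartite (colour , proper) =
    colour ∘ proj₁ , λ (i , i∈s) (j , j∈s) adj same → proper i∈s j∈s (proj₁ adj) same adj

  -- `side` takes a membership proof, so the colour of a disk uses the proof that `_∈?_` finds;
  -- outside `s` it is arbitrary.
  bipartite⇒independent : ∀ {s} → InducesBipartite D s → Independent s
  bipartite⇒independent {s} (side , splits) = (λ i → colour i (i ∈? s)) , proper
    where
    colour : ∀ i → Dec (i ∈ s) → Bool
    colour i (yes i∈s) = side (i , i∈s)
    colour i (no _)    = true
    proper : Proper s (λ i → colour i (i ∈? s))
    proper {i} {j} i∈s j∈s _ same adj with i ∈? s | j ∈? s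
    ... | yes p | yes q = splits (i , p) (j , q) adj same
    ... | no  p | _     = p i∈s
    ... | yes _ | no q  = q j∈s

  maximum-bipartite : ∀ {s} → Independent s → (∀ t → Independent t → ∣ t ∣ ≤ ∣ s ∣) →
                      MaximumBipartite D s
  maximum-bipartite ind bound = independent⇒bipartite ind , λ t bip → bound t (bipartite⇒independent bip)

  output-solution : ∀ {σ A s} → σ ≃ A → (∀ i → A (low (inject₁ i)) ≡ bit s i) → output σ ≡ s
  output-solution {σ} {A} {s} σ≃A bits = trans (tabulate-cong bit≡) (tabulate∘lookup s)
    where
    cell≡ : ∀ i → inject≤ i (ℕ.<⇒≤ n<S) ≡ address (low (inject₁ i))
    cell≡ i = Fin.toℕ-injective (trans (Fin.toℕ-inject≤ i _)
      (sym (trans (Fin.toℕ-↑ˡ (inject₁ i) _) (Fin.toℕ-inject₁ i))))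
    positive : ∀ b → does (1 ℕ.≤? (if b then 1 else 0)) ≡ b
    positive true  = refl
    positive false = refl
    bit≡ : ∀ i → does (1 ℕ.≤? toℕ (lookup (words σ) (inject≤ i (ℕ.<⇒≤ n<S)))) ≡ lookup s i
    bit≡ i = trans (cong (λ v → does (1 ℕ.≤? v))
      (trans (cong (toℕ ∘ lookup (words σ)) (cell≡ i))
        (trans (_≃_.contents σ≃A (low (inject₁ i))) (bits i))))
      (positive (lookup s i))

  correct : ∃[ σ ] ∃[ t ] ((⟨ program , initial L D ⟩⇓ σ taking t) × t ≤ time n ×
                           MaximumBipartite D (output σ))
  correct =
    let A , running run , s , independent , bound , bits = program-reaches
        σ , t , program⇓ , t≤ , σ≃A = run initial≃
    in σ , t , program⇓ , t≤ ,
       subst (MaximumBipartite D) (sym (output-solution σ≃A bits)) (maximum-bipartite independent bound)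

theorem19 : (ℝ : RealNumbers) →
  let open Plane ℝ in
  Σ[ program ∈ Program ] Σ[ time ∈ (ℕ → ℕ) ] Σ[ space ∈ (ℕ → ℕ) ]
  Σ[ fits ∈ (∀ n → inputSize n ≤ space n) ]
    time ∈O (λ n → n ^ 4) × space ∈O (λ n → n ^ 3) ×
    (∀ n (L : Line) (D : Disks n) →
      Distinct D → AllIntersect D L → CentersOnOneSide D L →
      let open RealRAM ℝ (space n)
          open InputOutput ℝ n (fits n) in
      ∃[ σ ] ∃[ t ] ((⟨ program , initial L D ⟩⇓ σ taking t) × t ≤ time n ×
                     MaximumBipartite D (output σ)))
theorem19 ℝ = program , time , space , fits , time∈O , space∈O ,
  λ n L D _ intersects oneSided → Correctness.correct ℝ n L D intersects oneSided
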